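{- For every integer $a\ge 0$, $\overline{T_a}=\mathbb{R}_{\ge 0}$ (closure in the Euclidean topology on $\mathbb{R}$). Moreover, $T_0=\mathbb{Q}_{>0}$.
   Context: Partitions are drawn as Young diagrams $\mathbb{D}(\lambda)$ in English notation; $c_{i,j}$ is the cell in row $i$, column $j$. The hook length $h_\lambda(c)$ is the number of cells of $\mathbb{D}(\lambda)$ weakly right of $c$ in its row or weakly below $c$ in its column (counting $c$ once). For $\mu\subseteq\lambda$, an excited diagram of $\lambda/\mu$ is a subset of $\mathbb{D}(\lambda)$ obtained from $\mathbb{D}(\mu)$ by repeatedly replacing a cell $c_{i,j}\in D$ by $c_{i+1,j+1}$, allowed iff $c_{i+1,j+1}\in\mathbb{D}(\lambda)$ and none of $c_{i,j+1},c_{i+1,j},c_{i+1,j+1}$ lies in $D$; $\mathbb{E}(\lambda/\mu)$ is their set. A ribbon with $n$ cells is read from its lower-left to its upper-right cell, each successive cell directly right of or directly above the previous; it corresponds to the set of $i\in\{1,\ldots,n-1\}$ with cell $i$ directly below cell $i+1$. A descent set is a non-empty finite set $I$ of positive integers; $\lambda^I$ is the unique partition with $\lambda^I_1=\lambda^I_2$ such that the cells $c_{i,j}\in\mathbb{D}(\lambda^I)$ with fewer than three of $c_{i,j+1},c_{i+1,j},c_{i+1,j+1}$ in $\mathbb{D}(\lambda^I)$ form a ribbon corresponding to $I$; this ribbon is $\mathbb{D}(\lambda^I)\setminus\mathbb{D}(\mu^I)$ for a partition $\mu^I$. Let $s(I)=\lambda^I_1-1$. Naruse-Newton coefficients: every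 excited diagram of $\lambda^I/\mu^I$ meets row 1 in $\{c_{1,1},\ldots,c_{1,r}\}$, $0\le r\le s$; for $0\le j\le s(I)$, $C_j(I)=\sum_D\prod_{c\in D,\,c\notin\text{row }1}h_{\lambda^I}(c)$, summed over $D\in\mathbb{E}(\lambda^I/\mu^I)$ with exactly $s-j$ cells in row 1. For an integer $a\ge0$, $T_a=\{C_{s-a-1}(I)/C_{s-a}(I)\mid I\text{ a descent set with } s=s(I)\ge a+1\}$. -}

module Defs where

open import Level using (0ℓ) renaming (suc to lsuc)
open import Data.Bool.Base using (if_then_else_)
open import Data.Empty using (⊥-elim)
import Data.Integer.Base as ℤ
open import Data.List.Base using (List; []; _∷_; _++_; map; filter; length; upTo; cartesianProduct)
import Data.List.Properties as List
open import Data.List.Membership.Propositional using (_∈_; _∉_; find; lose)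
open import Data.List.Membership.Propositional.Properties using (∈-filter⁺; ∈-filter⁻; ∈-cartesianProduct⁺; ∈-upTo⁺)
open import Data.List.Relation.Unary.All using (All; []; _∷_)
open import Data.List.Relation.Unary.AllPairs using ([]; _∷_)
open import Data.List.Relation.Unary.Any using (here; there; any?)
open import Data.List.Relation.Unary.Linked using (Linked; []; [-]; _∷_)
open import Data.List.Relation.Unary.Unique.Propositional using (Unique)
import Data.List.Relation.Unary.Unique.Propositional.Properties as Unique
open import Data.Nat.ListAction using (sum; product)
open import Data.Nat.Base using (ℕ; zero; suc; _+_; _∸_; _≤_; _<_; _≥_; z≤n; s≤s; NonZero)
import Data.Nat.Properties as ℕ
import Algebra.Properties.CommutativeSemigroup ℕ.+-commutativeSemigroup as ℕ-+
open import Data.Product.Base using (∃-syntax; Σ-syntax; _×_; _,_; proj₁; proj₂)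
open import Data.Product.Properties using (≡-dec)
open import Data.Rational.Base as ℚ using (ℚ; 0ℚ)
import Data.Rational.Properties as ℚ
open import Data.Sum.Base using (_⊎_; inj₁; inj₂)
open import Function.Base using (_∘_)
open import Function.Bundles using (_⇔_; mk⇔)
open import Relation.Binary.Construct.Closure.ReflexiveTransitive using (Star; ε; _◅_)
open import Relation.Binary.Definitions using (DecidableEquality)
open import Relation.Binary.PropositionalEquality using (_≡_; _≢_; refl; sym; cong; subst; module ≡-Reasoning)
open import Relation.Nullary.Decidable using (Dec; yes; no; does; ¬?; _×-dec_; _⊎-dec_; map′)
open import Relation.Nullary.Negation using (¬_)
open import Relation.Unary using (Pred; Decidable)

------------------------------------------------------------------------
-- Cells and partitions

-- Rows and columns are counted from 0: the pair (i , j) is the cell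
-- c_{i+1,j+1}.
Cell : Set
Cell = ℕ × ℕ

right down diag : Cell → Cell
right (i , j) = i , suc j
down  (i , j) = suc i , j
diag  (i , j) = suc i , suc j

_≟ᶜ_ : DecidableEquality Cell
_≟ᶜ_ = ≡-dec ℕ._≟_ ℕ._≟_

_≟ᴰ_ : DecidableEquality (List Cell)
_≟ᴰ_ = List.≡-dec _≟ᶜ_

open import Data.List.Membership.DecPropositional _≟ᶜ_ using (_∈?_)

record Partition : Set where
  field
    parts      : List ℕ
    decreasing : Linked _≥_ parts
    positive   : All (0 <_) parts

open Partition public

nth : List ℕ → ℕ → ℕ
nth []       _       = 0
nth (x ∷ xs) zero    = x
nth (x ∷ xs) (suc i) = nth xs i

-- part lam i is λ_{i+1}, with the convention that missing parts are 0.
part : Partition → ℕ → ℕ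
part lam = nth (parts lam)

infix 4 _∈𝔻_ _∈𝔻?_

_∈𝔻_ : Cell → Partition → Set
(i , j) ∈𝔻 lam = j < part lam i

_∈𝔻?_ : ∀ c lam → Dec (c ∈𝔻 lam)
(i , j) ∈𝔻? lam = j ℕ.<? part lam i

cells : Partition → List Cell
cells lam = filter (_∈𝔻? lam) (cartesianProduct (upTo (length (parts lam))) (upTo (part lam 0)))

nth-≤-head : ∀ {xs} → Linked _≥_ xs → ∀ i → nth xs i ≤ nth xs 0
nth-≤-head []            _       = z≤n
nth-≤-head _             zero    = ℕ.≤-refl
nth-≤-head [-]           (suc _) = z≤n
nth-≤-head (x≥y ∷ lnk)   (suc i) = ℕ.≤-trans (nth-≤-head lnk i) x≥y

nth-<-length : ∀ xs {i j} → j < nth xs i → i < length xs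
nth-<-length (_ ∷ _)  {zero}  _ = s≤s z≤n
nth-<-length (_ ∷ xs) {suc _} p = s≤s (nth-<-length xs p)

∈-cells⁺ : ∀ lam {c} → c ∈𝔻 lam → c ∈ cells lam
∈-cells⁺ lam {i , j} p = ∈-filter⁺ (_∈𝔻? lam)
  (∈-cartesianProduct⁺ (∈-upTo⁺ (nth-<-length (parts lam) p))
                       (∈-upTo⁺ (ℕ.<-≤-trans p (nth-≤-head (decreasing lam) i))))
  p

∈-cells⁻ : ∀ lam {c} → c ∈ cells lam → c ∈𝔻 lam
∈-cells⁻ lam c∈ = proj₂ (∈-filter⁻ (_∈𝔻? lam) {xs = grid} c∈)
  where grid = cartesianProduct (upTo (length (parts lam))) (upTo (part lam 0))

cells-unique : ∀ lam → Unique (cells lam)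
cells-unique lam = Unique.filter⁺ (_∈𝔻? lam)
  (Unique.cartesianProduct⁺ (Unique.upTo⁺ (length (parts lam))) (Unique.upTo⁺ (part lam 0)))

InHook : Cell → Cell → Set
InHook (i , j) (i′ , j′) = (i ≡ i′ × j ≤ j′) ⊎ (j ≡ j′ × i ≤ i′)

inHook? : ∀ c → Decidable (InHook c)
inHook? (i , j) (i′ , j′) =
  ((i ℕ.≟ i′) ×-dec (j ℕ.≤? j′)) ⊎-dec ((j ℕ.≟ j′) ×-dec (i ℕ.≤? i′))

hook : Partition → Cell → ℕ
hook lam c = length (filter (inHook? c) (cells lam))

------------------------------------------------------------------------
-- Excited diagrams

-- A subset of 𝔻(λ) is represented by the sublist of `cells lam`
-- consisting of its elements, so that equal sets are equal lists.

subsets : ∀ {A : Set} → List A → List (List A)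
subsets []       = [] ∷ []
subsets (x ∷ xs) = map (x ∷_) (subsets xs) ++ subsets xs

module _ (lam : Partition) where

  Excitable : List Cell → Cell → Set
  Excitable D c = diag c ∈𝔻 lam × right c ∉ D × down c ∉ D × diag c ∉ D

  Excited-cell : List Cell → Cell → Cell → Set
  Excited-cell D c x = (x ∈ D × x ≢ c) ⊎ x ≡ diag c

  excited-cell? : ∀ D c → Decidable (Excited-cell D c)
  excited-cell? D c x = ((x ∈? D) ×-dec ¬? (x ≟ᶜ c)) ⊎-dec (x ≟ᶜ diag c)

  excite : List Cell → Cell → List Cell
  excite D c = filter (excited-cell? D c) (cells lam)

  infix 4 _⟶_

  _⟶_ : List Cell → List Cell → Set
  D ⟶ D′ = ∃[ c ] (c ∈ D × Excitable D c × D′ ≡ excite D c)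

  initial : Partition → List Cell
  initial mu = filter (_∈𝔻? mu) (cells lam)

  IsExcited : Partition → List Cell → Set
  IsExcited mu D = Star _⟶_ (initial mu) D

  excitable? : ∀ D → Decidable (Excitable D)
  excitable? D c =
    (diag c ∈𝔻? lam) ×-dec ¬? (right c ∈? D) ×-dec ¬? (down c ∈? D) ×-dec ¬? (diag c ∈? D)

  -- Reachability is decidable because each excited move increases the
  -- sum φ of the row indices of the cells of the diagram.
  private
    ite : ∀ {P : Set} → Dec P → ℕ → ℕ
    ite d n = if does d then n else 0

    ite-no : ∀ {P : Set} (d : Dec P) {n} → ¬ P → ite d n ≡ 0
    ite-no (yes p) ¬p = ⊥-elim (¬p p)
    ite-no (no _)  ¬p = refl

    ite-yes : ∀ {P : Set} (d : Dec P) {n} → P → ite d n ≡ n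
    ite-yes (yes _) p = refl
    ite-yes (no ¬p) p = ⊥-elim (¬p p)

    ite-≤ : ∀ {P : Set} (d : Dec P) {n} → ite d n ≤ n
    ite-≤ (yes _) = ℕ.≤-refl
    ite-≤ (no _)  = z≤n

    ite-mono : ∀ {P Q : Set} (d : Dec P) (e : Dec Q) {n} → (P → Q) → ite d n ≤ ite e n
    ite-mono (yes p) e f = ℕ.≤-reflexive (sym (ite-yes e (f p)))
    ite-mono (no _)  e f = z≤n

    Σ[_] : List Cell → (Cell → ℕ) → ℕ
    Σ[ xs ] f = sum (map f xs)

    Σ-+ : ∀ xs f g → Σ[ xs ] (λ x → f x + g x) ≡ Σ[ xs ] f + Σ[ xs ] g
    Σ-+ []       f g = refl
    Σ-+ (x ∷ xs) f g rewrite Σ-+ xs f g = ℕ-+.interchange (f x) (g x) (Σ[ xs ] f) (Σ[ xs ] g)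

    Σ-mono : ∀ xs {f g} → (∀ {x} → x ∈ xs → f x ≤ g x) → Σ[ xs ] f ≤ Σ[ xs ] g
    Σ-mono []       h = z≤n
    Σ-mono (x ∷ xs) h = ℕ.+-mono-≤ (h (here refl)) (Σ-mono xs (h ∘ there))

    row : List Cell → Cell → ℕ
    row D x = ite (x ∈? D) (proj₁ x)

    φ : List Cell → ℕ
    φ D = Σ[ cells lam ] (row D)

    δ : Cell → ℕ → Cell → ℕ
    δ c n x = ite (x ≟ᶜ c) n

    Σδ-≥ : ∀ {c n xs} → c ∈ xs → n ≤ Σ[ xs ] (δ c n)
    Σδ-≥ {c} {n} (here {x = x} c≡x) =
      ℕ.≤-trans (ℕ.≤-reflexive (sym (ite-yes (x ≟ᶜ c) (sym c≡x)))) (ℕ.m≤m+n _ _)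
    Σδ-≥ {c} {n} {x ∷ _} (there c∈) = ℕ.≤-trans (Σδ-≥ c∈) (ℕ.m≤n+m _ (δ c n x))

    Σδ-∉ : ∀ {c n xs} → All (c ≢_) xs → Σ[ xs ] (δ c n) ≡ 0
    Σδ-∉ []                              = refl
    Σδ-∉ {c} {n} (_∷_ {x = x} c≢x ps)
      rewrite ite-no (x ≟ᶜ c) {n} (c≢x ∘ sym) = Σδ-∉ ps

    Σδ-≤ : ∀ {c n xs} → Unique xs → Σ[ xs ] (δ c n) ≤ n
    Σδ-≤ []                                    = z≤n
    Σδ-≤ {c} {n} (_∷_ {x = x} {xs = xs} x∉ u) with x ≟ᶜ c
    ... | no _     = Σδ-≤ u
    ... | yes refl = ℕ.≤-reflexive (begin
      n + Σ[ xs ] (δ c n) ≡⟨ cong (n +_) (Σδ-∉ {n = n} x∉) ⟩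
      n + 0               ≡⟨ ℕ.+-identityʳ n ⟩
      n                   ∎)
      where open ≡-Reasoning

    diag≢ : ∀ {c} → diag c ≢ c
    diag≢ ()

    row-excite : ∀ {D c x} → Excitable D c → x ∈ cells lam →
                 row D x + δ (diag c) (suc (proj₁ c)) x ≤ row (excite D c) x + δ c (proj₁ c) x
    row-excite {D} {c} {x} (_ , _ , _ , dc∉D) x∈ with x ≟ᶜ diag c
    ... | yes refl
      rewrite ite-no (x ∈? D) {proj₁ x} dc∉D
            | ite-yes (x ∈? excite D c) {proj₁ x} (∈-filter⁺ (excited-cell? D c) x∈ (inj₂ refl))
      = ℕ.m≤m+n _ _
    ... | no x≢dc rewrite ℕ.+-identityʳ (row D x) with x ≟ᶜ c
    ...   | yes refl = ℕ.≤-trans (ite-≤ (x ∈? D)) (ℕ.m≤n+m _ _)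
    ...   | no x≢c   = ℕ.≤-trans
      (ite-mono (x ∈? D) (x ∈? excite D c)
        (λ x∈D → ∈-filter⁺ (excited-cell? D c) x∈ (inj₁ (x∈D , x≢c))))
      (ℕ.m≤m+n _ _)

    φ-excite : ∀ {D c} → Excitable D c → φ D < φ (excite D c)
    φ-excite {D} {c} ex = ℕ.+-cancelʳ-≤ r _ _ (begin
      suc (φ D) + r                                  ≡⟨ ℕ.+-suc (φ D) r ⟨
      φ D + suc r                                    ≤⟨ ℕ.+-monoʳ-≤ (φ D) (Σδ-≥ (∈-cells⁺ lam (proj₁ ex))) ⟩
      φ D + Σ[ L ] (δ (diag c) (suc r))              ≡⟨ Σ-+ L (row D) (δ (diag c) (suc r)) ⟨
      Σ[ L ] (λ x → row D x + δ (diag c) (suc r) x)  ≤⟨ Σ-mono L (row-excite {D} ex) ⟩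
      Σ[ L ] (λ x → row (excite D c) x + δ c r x)    ≡⟨ Σ-+ L (row (excite D c)) (δ c r) ⟩
      φ (excite D c) + Σ[ L ] (δ c r)                ≤⟨ ℕ.+-monoʳ-≤ (φ (excite D c)) (Σδ-≤ (cells-unique lam)) ⟩
      φ (excite D c) + r                             ∎)
      where
      open ℕ.≤-Reasoning
      r = proj₁ c
      L = cells lam

    φ-star : ∀ {D E} → Star _⟶_ D E → φ D ≤ φ E
    φ-star ε                           = ℕ.≤-refl
    φ-star ((_ , _ , ex , refl) ◅ D⟶*E) = ℕ.≤-trans (ℕ.<⇒≤ (φ-excite ex)) (φ-star D⟶*E)

    reach? : ∀ n D E → φ E ≤ n + φ D → Dec (Star _⟶_ D E)
    step? : ∀ n D E → φ E ≤ suc n + φ D → Decidable (λ c → Excitable D c × Star _⟶_ (excite D c) E)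

    step? n D E bound c with excitable? D c
    ... | no ¬ex = no (¬ex ∘ proj₁)
    ... | yes ex = map′ (ex ,_) proj₂ (reach? n (excite D c) E (ℕ.≤-trans bound
      (ℕ.≤-trans (ℕ.≤-reflexive (sym (ℕ.+-suc n (φ D)))) (ℕ.+-monoʳ-≤ n (φ-excite ex)))))

    reach? n D E bound with D ≟ᴰ E
    reach? n       D E bound | yes refl = yes ε
    reach? zero    D E bound | no D≢E = no λ where
      ε                            → D≢E refl
      ((_ , _ , ex , refl) ◅ D⟶*E) → ℕ.<⇒≱ (φ-excite ex) (ℕ.≤-trans (φ-star D⟶*E) bound)
    reach? (suc n) D E bound | no D≢E with any? (step? n D E bound) D
    ... | yes some = let c , c∈D , ex , D⟶*E = find some in yes ((c , c∈D , ex , refl) ◅ D⟶*E)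
    ... | no none  = no λ where
      ε                                → D≢E refl
      ((c , c∈D , ex , refl) ◅ D⟶*E)   → none (lose c∈D (ex , D⟶*E))

  isExcited? : ∀ mu → Decidable (IsExcited mu)
  isExcited? mu D = reach? (φ D) (initial mu) D (ℕ.m≤m+n (φ D) _)

𝔼 : Partition → Partition → List (List Cell)
𝔼 lam mu = filter (isExcited? lam mu) (subsets (cells lam))

------------------------------------------------------------------------
-- Descent sets and their ribbons

record DescentSet : Set where
  field
    elements   : List ℕ
    increasing : Linked _<_ elements
    positive   : All (0 <_) elements
    nonempty   : elements ≢ []

IsRibbon : List Cell → Set
IsRibbon = Linked (λ c c′ → c′ ≡ right c ⊎ c ≡ down c′)

-- The ith cell of the list, counted from 1, lies directly below the
-- (i+1)st.
RisesAt : List Cell → ℕ → Set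
RisesAt r i = ∃[ xs ] ∃[ c ] ∃[ ys ] (r ≡ xs ++ down c ∷ c ∷ ys × i ≡ suc (length xs))

Rim : Partition → Cell → Set
Rim lam c = c ∈𝔻 lam × ¬ (right c ∈𝔻 lam × down c ∈𝔻 lam × diag c ∈𝔻 lam)

-- The pair (λ^I , μ^I), given by its defining properties, which
-- determine both partitions.
record Shape (I : DescentSet) : Set where
  open DescentSet I using (elements)
  field
    lam mu    : Partition
    firstRows : part lam 0 ≡ part lam 1
    ribbon    : List Cell
    isRibbon  : IsRibbon ribbon
    isRim     : ∀ c → c ∈ ribbon ⇔ Rim lam c
    descents  : ∀ i → i ∈ elements ⇔ RisesAt ribbon i
    inner     : ∀ c → c ∈𝔻 mu ⇔ (c ∈𝔻 lam × c ∉ ribbon)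

------------------------------------------------------------------------
-- Naruse-Newton coefficients

InFirstRow : Cell → Set
InFirstRow (i , _) = i ≡ 0

inFirstRow? : Decidable InFirstRow
inFirstRow? (i , _) = i ℕ.≟ 0

module _ {I : DescentSet} (S : Shape I) where
  open Shape S

  s : ℕ
  s = part lam 0 ∸ 1

  weight : List Cell → ℕ
  weight D = product (map (hook lam) (filter (¬? ∘ inFirstRow?) D))

  -- Meaningful for 0 ≤ j ≤ s.
  C : ℕ → ℕ
  C j = sum (map weight (filter (λ D → length (filter inFirstRow? D) ℕ.≟ s ∸ j) (𝔼 lam mu)))

-- `nz` only makes the quotient well formed: C_j(I) is positive for
-- 0 ≤ j ≤ s(I).
T : ℕ → Pred ℚ 0ℓ
T a q = Σ[ I ∈ DescentSet ] Σ[ S ∈ Shape I ] (suc a ≤ s S ×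
  Σ[ nz ∈ NonZero (C S (s S ∸ a)) ] q ≡ ℚ._/_ (ℤ.+ C S (s S ∸ a ∸ 1)) (C S (s S ∸ a)) {{nz}})

------------------------------------------------------------------------
-- Real numbers, as two-sided Dedekind cuts

record ℝ : Set₁ where
  field
    Lower Upper : Pred ℚ 0ℓ
    lower-inhabited : ∃[ p ] Lower p
    upper-inhabited : ∃[ p ] Upper p
    lower-rounded   : ∀ p → Lower p ⇔ (∃[ q ] (p ℚ.< q × Lower q))
    upper-rounded   : ∀ q → Upper q ⇔ (∃[ p ] (p ℚ.< q × Upper p))
    disjoint        : ∀ p → ¬ (Lower p × Upper p)
    located         : ∀ p q → p ℚ.< q → Lower p ⊎ Upper q

open ℝ public

infix 4 _≈ᴿ_ _≤ᴿ_

_≈ᴿ_ _≤ᴿ_ : ℝ → ℝ → Set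
x ≤ᴿ y = ∀ p → Lower x p → Lower y p
x ≈ᴿ y = x ≤ᴿ y × y ≤ᴿ x

fromℚ : ℚ → ℝ
fromℚ r = record
  { Lower           = ℚ._< r
  ; Upper           = r ℚ.<_
  ; lower-inhabited = r ℚ.- ℚ.1ℚ , r-1<r
  ; upper-inhabited = r ℚ.+ ℚ.1ℚ , r<r+1
  ; lower-rounded   = λ p → mk⇔ ℚ.<-dense (λ (_ , p<q , q<r) → ℚ.<-trans p<q q<r)
  ; upper-rounded   = λ q → mk⇔ (λ r<q → let p , r<p , p<q = ℚ.<-dense r<q in p , p<q , r<p)
                                (λ (_ , p<q , r<p) → ℚ.<-trans r<p p<q)
  ; disjoint        = λ p (p<r , r<p) → ℚ.<-asym p<r r<p
  ; located         = located-r
  }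
  where
  r-1<r : r ℚ.- ℚ.1ℚ ℚ.< r
  r-1<r = subst (r ℚ.- ℚ.1ℚ ℚ.<_) (ℚ.+-identityʳ r) (ℚ.+-monoʳ-< r (ℚ.negative⁻¹ (ℚ.- ℚ.1ℚ)))

  r<r+1 : r ℚ.< r ℚ.+ ℚ.1ℚ
  r<r+1 = subst (ℚ._< r ℚ.+ ℚ.1ℚ) (ℚ.+-identityʳ r) (ℚ.+-monoʳ-< r (ℚ.positive⁻¹ ℚ.1ℚ))

  located-r : ∀ p q → p ℚ.< q → p ℚ.< r ⊎ r ℚ.< q
  located-r p q p<q with p ℚ.<? r
  ... | yes p<r = inj₁ p<r
  ... | no p≮r  = inj₂ (ℚ.≤-<-trans (ℚ.≮⇒≥ p≮r) p<q)

ℝ≥0 : Pred ℝ 0ℓ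
ℝ≥0 x = fromℚ 0ℚ ≤ᴿ x

-- A set of rationals, regarded as a set of reals.
image : Pred ℚ 0ℓ → Pred ℝ 0ℓ
image A x = ∃[ q ] (A q × x ≈ᴿ fromℚ q)

-- The open intervals with rational endpoints form a base of the
-- Euclidean topology; p < x < q means that Lower x p and Upper x q.
closure : Pred ℝ 0ℓ → Pred ℝ (lsuc 0ℓ)
closure A x = ∀ p q → Lower x p → Upper x q → ∃[ y ] (A y × Lower y p × Upper y q)

{-# OPTIONS --safe #-}

-- Rectangles suffice.  If λ^I is an (n+1) × N rectangle, then μ^I is an
-- n × (N-1) rectangle, each cell of μ^I moves at most once, and the cells
-- that have not moved form a partition ν; so excited diagrams are weakly
-- decreasing sequences ν, and ν_1 is the number of cells in row 1.  The
-- weight is a product over rows, which gives a recursion in n for the sums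
-- over all ν with given ν_1 = k; it yields
-- C_{s-k-1} / C_{s-k} = (n + k) / ((k + 1)(N - k - 1)).
-- With k = a, N = a + 1 + d and n + a = (a + 1) u this is u / d, so T_a
-- contains every positive rational.  Conversely T_0 is positive because a
-- sequence of excited moves that empties row 1 passes through a diagram
-- with exactly one cell in row 1.

module Submission where

open import Data.Empty using (⊥-elim)
import Data.Integer.Base as ℤ
import Data.Integer.Properties as ℤ
open import Data.List.Base
  using (List; []; _∷_; _++_; map; filter; length; applyUpTo; upTo; cartesianProduct; replicate)
import Data.List.Properties as List
open import Data.List.Membership.Propositional using (_∈_; _∉_)
open import Data.List.Membership.Propositional.Properties
  using (∈-map⁺; ∈-map⁻; ∈-++⁺ˡ; ∈-++⁺ʳ; ∈-++⁻; ∈-filter⁺; ∈-filter⁻; ∈-applyUpTo⁺; ∈-applyUpTo⁻;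
         ∈-upTo⁻; ∈-cartesianProduct⁻)
open import Data.List.Membership.Propositional.Properties.WithK using (unique∧set⇒bag)
open import Data.List.Relation.Binary.BagAndSetEquality using (∼bag⇒↭)
open import Data.List.Relation.Binary.Permutation.Propositional using (_↭_)
open import Data.List.Relation.Binary.Permutation.Propositional.Properties using (↭-length) renaming (map⁺ to ↭-map⁺)
open import Data.List.Relation.Unary.All as All using ([]; _∷_)
import Data.List.Relation.Unary.All.Properties as All
open import Data.List.Relation.Unary.AllPairs using ([]; _∷_)
open import Data.List.Relation.Unary.Any using (here; there)
open import Data.List.Relation.Unary.Linked using (Linked; []; [-]; _∷_)
import Data.List.Relation.Unary.Linked.Properties as Linked
open import Data.List.Relation.Unary.Unique.Propositional using (Unique)
import Data.List.Relation.Unary.Unique.Propositional.Properties as Unique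
open import Data.Nat.Base
  using (ℕ; zero; suc; pred; _+_; _*_; _∸_; _⊓_; _≤_; _<_; _≥_; z≤n; s≤s; s≤s⁻¹;
         NonZero; ≢-nonZero; ≢-nonZero⁻¹; >-nonZero; >-nonZero⁻¹)
open import Data.Nat.Coprimality using (Coprime)
open import Data.Nat.ListAction using (sum; product)
open import Data.Nat.ListAction.Properties using (sum-++; sum-↭; product-++; product≢0)
import Data.Nat.Properties as ℕ
open import Data.Nat.Tactic.RingSolver using (solve-∀)
open import Data.Product.Base using (∃-syntax; _×_; _,_; proj₁; proj₂)
open import Data.Rational.Base as ℚ using (mkℚ; 0ℚ)
import Data.Rational.Properties as ℚ
open import Data.Rational.Unnormalised.Base using (mkℚᵘ; *≡*)
open import Data.Sum.Base using (_⊎_; inj₁; inj₂; [_,_]′)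
open import Function.Base using (_∘_; id)
open import Function.Bundles using (_⇔_; mk⇔; module Equivalence)
open import Level using (0ℓ)
open import Relation.Binary.Construct.Closure.ReflexiveTransitive using (Star; ε; _◅_; _◅◅_; gmap)
open import Relation.Binary.Definitions using (tri<; tri≈; tri>)
open import Relation.Binary.PropositionalEquality
  using (_≡_; _≢_; refl; sym; trans; cong; cong₂; subst; module ≡-Reasoning)
open import Relation.Nullary.Decidable using (yes; no; ¬?; _⊎-dec_)
open import Relation.Nullary.Negation using (¬_)
open import Relation.Unary using (Pred; Decidable; _≐_)
open import Defs

open Equivalence using (to; from)

-- Lists

-- Lets lengths of, and sums over, filtered lists be evaluated by exhibiting an explicit
-- duplicate-free enumeration of the same elements.
unique⇒↭ : ∀ {A : Set} {xs ys : List A} → Unique xs → Unique ys →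
           (∀ {x} → x ∈ xs → x ∈ ys) → (∀ {x} → x ∈ ys → x ∈ xs) → xs ↭ ys
unique⇒↭ u v f g = ∼bag⇒↭ (unique∧set⇒bag u v (mk⇔ f g))

map-unique : ∀ {A B : Set} {f : A → B} {xs} →
             (∀ {x y} → x ∈ xs → y ∈ xs → f x ≡ f y → x ≡ y) → Unique xs → Unique (map f xs)
map-unique inj []        = []
map-unique inj (x∉ ∷ u) =
  All.map⁺ (All.tabulate λ y∈ fx≡fy → All.lookup x∉ y∈ (inj (here refl) (there y∈) fx≡fy))
  ∷ map-unique (λ x∈ y∈ → inj (there x∈) (there y∈)) u

-- Diagrams are filters of the one list `cells lam`, so this turns equality of sets of cells into
-- equality of lists.
filter-cong : ∀ {A : Set} {P Q : Pred A 0ℓ} (P? : Decidable P) (Q? : Decidable Q) xs →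
              (∀ {x} → x ∈ xs → P x → Q x) → (∀ {x} → x ∈ xs → Q x → P x) → filter P? xs ≡ filter Q? xs
filter-cong P? Q? []       f g = refl
filter-cong P? Q? (x ∷ xs) f g with P? x
... | yes p = trans (cong (x ∷_) (filter-cong P? Q? xs (f ∘ there) (g ∘ there)))
                    (sym (List.filter-accept Q? (f (here refl) p)))
... | no ¬p = trans (filter-cong P? Q? xs (f ∘ there) (g ∘ there))
                    (sym (List.filter-reject Q? (¬p ∘ g (here refl))))

filter∈subsets : ∀ {A : Set} {P : Pred A 0ℓ} (P? : Decidable P) xs → filter P? xs ∈ subsets xs
filter∈subsets P? []       = here refl
filter∈subsets P? (x ∷ xs) with P? x
... | yes _ = ∈-++⁺ˡ (∈-map⁺ (x ∷_) (filter∈subsets P? xs))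
... | no _  = ∈-++⁺ʳ (map (x ∷_) (subsets xs)) (filter∈subsets P? xs)

∈subsets⇒⊆ : ∀ {A : Set} (xs : List A) {ys} → ys ∈ subsets xs → ∀ {y} → y ∈ ys → y ∈ xs
∈subsets⇒⊆ []       (here refl) ()
∈subsets⇒⊆ (x ∷ xs) ys∈ y∈ with ∈-++⁻ (map (x ∷_) (subsets xs)) ys∈
... | inj₂ ys∈′ = there (∈subsets⇒⊆ xs ys∈′ y∈)
... | inj₁ ys∈′ with ∈-map⁻ (x ∷_) ys∈′ | y∈
...   | _ , _ , refl    | here refl = here refl
...   | _ , zs∈ , refl  | there y∈′ = there (∈subsets⇒⊆ xs zs∈ y∈′)

-- Ensures that a sum over `𝔼` counts each excited diagram once.
subsets-unique : ∀ {A : Set} {xs : List A} → Unique xs → Unique (subsets xs)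
subsets-unique []                         = [] ∷ []
subsets-unique {xs = x ∷ xs} (x∉ ∷ u) =
  Unique.++⁺ (Unique.map⁺ List.∷-injectiveʳ (subsets-unique u)) (subsets-unique u) apart
  where
  apart : ∀ {ys} → ¬ (ys ∈ map (x ∷_) (subsets xs) × ys ∈ subsets xs)
  apart (ys∈₁ , ys∈₂) with ∈-map⁻ (x ∷_) ys∈₁
  ... | _ , _ , refl = All.lookup x∉ (∈subsets⇒⊆ xs ys∈₂ (here refl)) refl

-- Consecutive entries appear in the form in which `RisesAt` presents two consecutive cells of a
-- ribbon.
applyUpTo-split⁻ : ∀ {A : Set} (g : ℕ → A) L xs {a b ys} → applyUpTo g L ≡ xs ++ a ∷ b ∷ ys →
                   suc (length xs) < L × a ≡ g (length xs) × b ≡ g (suc (length xs))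
applyUpTo-split⁻ g (suc (suc L)) []       refl = s≤s (s≤s z≤n) , refl , refl
applyUpTo-split⁻ g (suc L)       (x ∷ xs) eq   =
  let k<L , a≡ , b≡ = applyUpTo-split⁻ (g ∘ suc) L xs (List.∷-injectiveʳ eq) in s≤s k<L , a≡ , b≡
applyUpTo-split⁻ g (suc zero)    []       ()
applyUpTo-split⁻ g zero          []       ()
applyUpTo-split⁻ g zero          (_ ∷ _)  ()

applyUpTo-split⁺ : ∀ {A : Set} (g : ℕ → A) L k → suc k < L →
                   ∃[ ys ] applyUpTo g L ≡ applyUpTo g k ++ g k ∷ g (suc k) ∷ ys
applyUpTo-split⁺ g (suc (suc L)) zero    _       = _ , refl
applyUpTo-split⁺ g (suc L)       (suc k) (s≤s p) =
  let ys , eq = applyUpTo-split⁺ (g ∘ suc) L k p in ys , cong (g 0 ∷_) eq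
applyUpTo-split⁺ g (suc zero)    zero    (s≤s ())

-- Weakly decreasing sequences and their weights

sum-map-* : ∀ {A : Set} c (f : A → ℕ) xs → sum (map (λ x → c * f x) xs) ≡ c * sum (map f xs)
sum-map-* c f []       = sym (ℕ.*-zeroʳ c)
sum-map-* c f (x ∷ xs) = trans (cong (c * f x +_) (sum-map-* c f xs)) (sym (ℕ.*-distribˡ-+ c (f x) _))

-- Recursion on the bound l, splitting off the lists whose first entry is exactly `suc l`, matches
-- the partial sums `L` below.
decreasingLists : ℕ → ℕ → List (List ℕ)
decreasingLists zero    l       = [] ∷ []
decreasingLists (suc r) zero    = map (zero ∷_) (decreasingLists r zero)
decreasingLists (suc r) (suc l) = decreasingLists (suc r) l ++ map (suc l ∷_) (decreasingLists r (suc l))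

-- The last of the N cells of a row of a rectangle with r rows below it
-- has hook length r + 1.  α r N x and β r N l are the products of the
-- hook lengths of the first x cells, and of the cells after the first
-- l + 1, of such a row.
α : ℕ → ℕ → ℕ → ℕ
α r N       zero    = 1
α r zero    (suc x) = 1
α r (suc N) (suc x) = (suc N + r) * α r N x

-- The rising factorial (r+1)(r+2)...(r+b): the product of the hook lengths of the last b cells of a
-- row with r rows below it.
rising : ℕ → ℕ → ℕ
rising r zero    = 1
rising r (suc b) = rising r b * (r + suc b)

β : ℕ → ℕ → ℕ → ℕ
β r N l = rising r (N ∸ suc l)

-- With N = x + suc b, the added cell lies in column x and has hook length N - x + r.
α-suc : ∀ r x b → α r (x + suc b) (suc x) ≡ α r (x + suc b) x * (suc b + r)
α-suc r zero    b = ℕ.*-comm (suc b + r) 1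
α-suc r (suc x) b = trans (cong ((suc (x + suc b) + r) *_) (α-suc r x b))
                          (sym (ℕ.*-assoc (suc (x + suc b) + r) (α r (x + suc b) x) (suc b + r)))

β-step : ∀ r k b → β r (k + suc (suc b)) k ≡ β r (k + suc (suc b)) (suc k) * (r + suc b)
β-step r zero    b = refl
β-step r (suc k) b = β-step r k b

α-positive : ∀ r N x → 0 < α r N x
α-positive r N       zero    = s≤s z≤n
α-positive r zero    (suc x) = s≤s z≤n
α-positive r (suc N) (suc x) = ℕ.≤-trans (α-positive r N x) (ℕ.m≤m+n _ _)

rising-positive : ∀ r b → 0 < rising r b
rising-positive r zero    = s≤s z≤n
rising-positive r (suc b) = ℕ.*-mono-≤ (rising-positive r b) (ℕ.≤-trans (s≤s z≤n) (ℕ.m≤n+m (suc b) r))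

-- Recursion and ratios for the weighted sums

module _ (N : ℕ) where

  -- Here r counts the rows below the current one, and l the unmoved cells of the row above, whose
  -- moved cells land after the first l + 1 positions. The base case is the bottom row of the
  -- rectangle, which holds moved cells only.
  rowsWeight : ℕ → ℕ → List ℕ → ℕ
  rowsWeight r l []       = β 0 N l
  rowsWeight r l (x ∷ xs) = α r N x * β r N l * rowsWeight (pred r) x xs

  -- `K` is the total weight for given r and l. `L` collects the contributions of all first entries
  -- up to l, with the common factor `β` taken out.
  K L : ℕ → ℕ → ℕ
  K zero    l = β 0 N l
  K (suc r) l = β (suc r) N l * L r l
  L r zero    = α (suc r) N zero * K r zero
  L r (suc l) = L r l + α (suc r) N (suc l) * K r (suc l)

  sum-rowsWeight : ∀ r l → sum (map (rowsWeight r l) (decreasingLists r l)) ≡ K r l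
  -- The bound l is kept apart from the weight parameter l′ because the induction lowers the bound
  -- while the row above stays fixed.
  sum-rowsWeight-≤ : ∀ r l′ l →
    sum (map (rowsWeight (suc r) l′) (decreasingLists (suc r) l)) ≡ β (suc r) N l′ * L r l
  sum-rowsWeight-head : ∀ r l′ x →
    sum (map (rowsWeight (suc r) l′) (map (x ∷_) (decreasingLists r x))) ≡
    β (suc r) N l′ * (α (suc r) N x * K r x)

  sum-rowsWeight zero    l = ℕ.+-identityʳ _
  sum-rowsWeight (suc r) l = sum-rowsWeight-≤ r l l

  sum-rowsWeight-≤ r l′ zero    = sum-rowsWeight-head r l′ zero
  sum-rowsWeight-≤ r l′ (suc l) = begin
    sum (map w (decreasingLists (suc r) l ++ new))         ≡⟨ cong sum (List.map-++ w (decreasingLists (suc r) l) new) ⟩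
    sum (map w (decreasingLists (suc r) l) ++ map w new)   ≡⟨ sum-++ (map w (decreasingLists (suc r) l)) _ ⟩
    sum (map w (decreasingLists (suc r) l)) + sum (map w new)
      ≡⟨ cong₂ _+_ (sum-rowsWeight-≤ r l′ l) (sum-rowsWeight-head r l′ (suc l)) ⟩
    β (suc r) N l′ * L r l + β (suc r) N l′ * _     ≡⟨ ℕ.*-distribˡ-+ (β (suc r) N l′) (L r l) _ ⟨
    β (suc r) N l′ * L r (suc l)                    ∎
    where
    open ≡-Reasoning
    w   = rowsWeight (suc r) l′
    new = map (suc l ∷_) (decreasingLists r (suc l))

  sum-rowsWeight-head r l′ x = begin
    sum (map w (map (x ∷_) (decreasingLists r x)))                   ≡⟨ cong sum (List.map-∘ (decreasingLists r x)) ⟨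
    sum (map (λ ν → a * b * rowsWeight r x ν) (decreasingLists r x)) ≡⟨ sum-map-* (a * b) (rowsWeight r x) (decreasingLists r x) ⟩
    a * b * sum (map (rowsWeight r x) (decreasingLists r x))      ≡⟨ cong (a * b *_) (sum-rowsWeight r x) ⟩
    a * b * K r x                                             ≡⟨ rearrange a b (K r x) ⟩
    b * (a * K r x)                                           ∎
    where
    open ≡-Reasoning
    w = rowsWeight (suc r) l′
    a = α (suc r) N x
    b = β (suc r) N l′
    rearrange : ∀ a b c → a * b * c ≡ b * (a * c)
    rearrange = solve-∀

  K-positive : ∀ r l → 0 < K r l
  L-positive : ∀ r l → 0 < L r l
  K-positive zero    l = rising-positive 0 (N ∸ suc l)
  K-positive (suc r) l = ℕ.*-mono-≤ (rising-positive (suc r) (N ∸ suc l)) (L-positive r l)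
  L-positive r zero    = ℕ.*-mono-≤ (α-positive (suc r) N zero) (K-positive r zero)
  L-positive r (suc l) = ℕ.≤-trans (L-positive r l) (ℕ.m≤m+n _ _)

-- Cross-multiplied form of K(r,k+1)/K(r,k) = (r+1+k)/((k+1)(N-k-1)), where b = N-k-2. Induction on
-- r: the ratio for r gives the ratio of consecutive summands of `L`, from which `invariant` yields
-- the ratio of its partial sums.
K-ratio : ∀ {N} r k b → k + suc (suc b) ≡ N →
          K N r (suc k) * (suc k * suc b) ≡ K N r k * (suc r + k)
K-ratio zero    k b refl = trans (rearrange (β 0 N (suc k)) k b) (cong (_* suc k) (sym (β-step 0 k b)))
  where
  N = k + suc (suc b)
  rearrange : ∀ x k b → x * (suc k * suc b) ≡ x * suc b * suc k
  rearrange = solve-∀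
K-ratio (suc r) k b refl = begin
  β R N (suc k) * L N r (suc k) * (suc k * suc b)               ≡⟨ ℕ.*-assoc (β R N (suc k)) _ _ ⟩
  β R N (suc k) * (L N r (suc k) * (suc k * suc b))             ≡⟨ cong (β R N (suc k) *_) (L-ratio k b refl) ⟩
  β R N (suc k) * (L N r k * ((suc R + k) * (R + suc b)))       ≡⟨ rearrange (β R N (suc k)) (L N r k) (suc R + k) (R + suc b) ⟩
  β R N (suc k) * (R + suc b) * L N r k * (suc R + k)           ≡⟨ cong (λ x → x * L N r k * (suc R + k)) (β-step R k b) ⟨
  β R N k * L N r k * (suc R + k)                               ∎
  where
  open ≡-Reasoning
  N = k + suc (suc b)
  R = suc r
  rearrange : ∀ x y z w → x * (y * (z * w)) ≡ x * w * y * z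
  rearrange = solve-∀

  g : ℕ → ℕ
  g x = α R N x * K N r x

  α-suc′ : ∀ k b → k + suc (suc b) ≡ N → α R N (suc k) ≡ α R N k * (suc (suc b) + R)
  α-suc′ k b eq rewrite sym eq = α-suc R k (suc b)

  g-ratio : ∀ k b → k + suc (suc b) ≡ N →
            g (suc k) * (suc k * suc b) ≡ g k * ((suc (suc b) + R) * (R + k))
  g-ratio k b eq = begin
    α R N (suc k) * K N r (suc k) * (suc k * suc b)              ≡⟨ ℕ.*-assoc (α R N (suc k)) _ _ ⟩
    α R N (suc k) * (K N r (suc k) * (suc k * suc b))            ≡⟨ cong₂ _*_ (α-suc′ k b eq) (K-ratio r k b eq) ⟩
    α R N k * (suc (suc b) + R) * (K N r k * (R + k))            ≡⟨ ring₁ (α R N k) (suc (suc b) + R) (K N r k) (R + k) ⟩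
    g k * ((suc (suc b) + R) * (R + k))                          ∎
    where
    ring₁ : ∀ x y z w → x * y * (z * w) ≡ x * z * (y * w)
    ring₁ = solve-∀

  -- The sum `L` telescopes in the manner of Gosper summation: every partial sum is an explicit
  -- rational multiple of the next summand.
  invariant : ∀ k b → k + suc (suc b) ≡ N →
              g (suc k) * (suc k * suc b) ≡ L N r k * (R * (R + (k + suc (suc b))))
  invariant zero    b eq = trans (g-ratio zero b eq) (cong (g 0 *_) (ring₂ (suc (suc b)) R))
    where
    ring₂ : ∀ x y → (x + y) * (y + 0) ≡ y * (y + x)
    ring₂ = solve-∀
  invariant (suc k) b eq = begin
    g (suc (suc k)) * (suc (suc k) * suc b)                ≡⟨ g-ratio (suc k) b eq ⟩
    -- The identity (x+R)(R+y) = xy + R(R+x+y), with x = b+2, y = k+1 and x+y = N, isolates the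
    -- product to which the induction hypothesis applies.
    g (suc k) * ((suc (suc b) + R) * (R + suc k))          ≡⟨ cong (g (suc k) *_) (ring₃ b R k) ⟩
    g (suc k) * (suc k * suc (suc b) + Z)                  ≡⟨ ℕ.*-distribˡ-+ (g (suc k)) (suc k * suc (suc b)) Z ⟩
    g (suc k) * (suc k * suc (suc b)) + g (suc k) * Z
      ≡⟨ cong (_+ g (suc k) * Z) (trans (invariant k (suc b) eq′) (cong (λ n → L N r k * (R * (R + n))) (ℕ.+-suc k (suc (suc b))))) ⟩
    L N r k * Z + g (suc k) * Z                            ≡⟨ ℕ.*-distribʳ-+ Z (L N r k) (g (suc k)) ⟨
    L N r (suc k) * Z                                      ∎
    where
    eq′ = trans (ℕ.+-suc k (suc (suc b))) eq
    Z = R * (R + (suc k + suc (suc b)))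
    ring₃ : ∀ b R k → (suc (suc b) + R) * (R + suc k) ≡ suc k * suc (suc b) + R * (R + (suc k + suc (suc b)))
    ring₃ = solve-∀

  L-ratio : ∀ k b → k + suc (suc b) ≡ N →
            L N r (suc k) * (suc k * suc b) ≡ L N r k * ((suc R + k) * (R + suc b))
  L-ratio k b eq = begin
    (L N r k + g (suc k)) * (suc k * suc b)                   ≡⟨ ℕ.*-distribʳ-+ (suc k * suc b) (L N r k) (g (suc k)) ⟩
    L N r k * (suc k * suc b) + g (suc k) * (suc k * suc b)   ≡⟨ cong (L N r k * (suc k * suc b) +_) (invariant k b eq) ⟩
    L N r k * (suc k * suc b) + L N r k * _                   ≡⟨ ℕ.*-distribˡ-+ (L N r k) (suc k * suc b) _ ⟨
    L N r k * (suc k * suc b + _)                             ≡⟨ cong (L N r k *_) (ring₄ b R k) ⟩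
    L N r k * ((suc R + k) * (R + suc b))                     ∎
    where
    ring₄ : ∀ b R k → suc k * suc b + R * (R + (k + suc (suc b))) ≡ (suc R + k) * (R + suc b)
    ring₄ = solve-∀

-- Enumerating weakly decreasing lists and lowering one entry

data Below : ℕ → List ℕ → Set where
  []  : ∀ {l} → Below l []
  _∷_ : ∀ {l x xs} → x ≤ l → Below x xs → Below l (x ∷ xs)

Below-weaken : ∀ {l l′ ν} → l ≤ l′ → Below l ν → Below l′ ν
Below-weaken l≤ []       = []
Below-weaken l≤ (x≤ ∷ b) = ℕ.≤-trans x≤ l≤ ∷ b

nth-Below : ∀ {l ν} → Below l ν → ∀ i → nth ν i ≤ l
nth-Below []       _       = z≤n
nth-Below (x≤ ∷ b) zero    = x≤
nth-Below (x≤ ∷ b) (suc i) = ℕ.≤-trans (nth-Below b i) x≤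

nth-antitone : ∀ {l ν} → Below l ν → ∀ i → nth ν (suc i) ≤ nth ν i
nth-antitone []       _       = z≤n
nth-antitone (x≤ ∷ b) zero    = nth-Below b 0
nth-antitone (x≤ ∷ b) (suc i) = nth-antitone b i

-- Lengths are compared as well, because `nth` does not distinguish trailing zeros from missing
-- entries.
nth-ext : ∀ {xs ys} → length xs ≡ length ys → (∀ i → nth xs i ≡ nth ys i) → xs ≡ ys
nth-ext {[]}     {[]}     _  _  = refl
nth-ext {x ∷ xs} {y ∷ ys} le eq = cong₂ _∷_ (eq 0) (nth-ext (ℕ.suc-injective le) (eq ∘ suc))

∈-decreasingLists⁻ : ∀ r l {ν} → ν ∈ decreasingLists r l → length ν ≡ r × Below l ν
∈-decreasingLists⁻ zero    l       (here refl) = refl , []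
∈-decreasingLists⁻ (suc r) zero    ν∈ with ∈-map⁻ (zero ∷_) ν∈
... | _ , ν′∈ , refl = let le , b = ∈-decreasingLists⁻ r zero ν′∈ in cong suc le , z≤n ∷ b
∈-decreasingLists⁻ (suc r) (suc l) ν∈ with ∈-++⁻ (decreasingLists (suc r) l) ν∈
... | inj₁ ν∈′ = let le , b = ∈-decreasingLists⁻ (suc r) l ν∈′ in le , Below-weaken (ℕ.n≤1+n l) b
... | inj₂ ν∈′ with ∈-map⁻ (suc l ∷_) ν∈′
...   | _ , ν′∈ , refl = let le , b = ∈-decreasingLists⁻ r (suc l) ν′∈ in cong suc le , ℕ.≤-refl ∷ b

∈-decreasingLists-∷ : ∀ r {x ν} l → x ≤ l → ν ∈ decreasingLists r x → x ∷ ν ∈ decreasingLists (suc r) l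
∈-decreasingLists-∷ r     zero    z≤n ν∈ = ∈-map⁺ (zero ∷_) ν∈
∈-decreasingLists-∷ r {x} (suc l) x≤  ν∈ with x ℕ.≟ suc l
... | yes refl = ∈-++⁺ʳ (decreasingLists (suc r) l) (∈-map⁺ (suc l ∷_) ν∈)
... | no x≢    = ∈-++⁺ˡ (∈-decreasingLists-∷ r l (s≤s⁻¹ (ℕ.≤∧≢⇒< x≤ x≢)) ν∈)

∈-decreasingLists⁺ : ∀ {l ν} → Below l ν → ν ∈ decreasingLists (length ν) l
∈-decreasingLists⁺ []             = here refl
∈-decreasingLists⁺ (x≤ ∷ b) = ∈-decreasingLists-∷ _ _ x≤ (∈-decreasingLists⁺ b)

decreasingLists-unique : ∀ r l → Unique (decreasingLists r l)
decreasingLists-unique zero    l       = [] ∷ []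
decreasingLists-unique (suc r) zero    = Unique.map⁺ List.∷-injectiveʳ (decreasingLists-unique r zero)
decreasingLists-unique (suc r) (suc l) =
  Unique.++⁺ (decreasingLists-unique (suc r) l) (Unique.map⁺ List.∷-injectiveʳ (decreasingLists-unique r (suc l))) apart
  where
  apart : ∀ {ν} → ¬ (ν ∈ decreasingLists (suc r) l × ν ∈ map (suc l ∷_) (decreasingLists r (suc l)))
  apart (ν∈₁ , ν∈₂) with ∈-map⁻ (suc l ∷_) ν∈₂
  ... | _ , _ , refl with proj₂ (∈-decreasingLists⁻ (suc r) l ν∈₁)
  ...   | l<l ∷ _ = ℕ.1+n≰n l<l

-- The counterpart of an excited move: the last unmoved cell of row i moves away.
lower : ℕ → List ℕ → List ℕ
lower _       []       = []
lower zero    (x ∷ xs) = pred x ∷ xs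
lower (suc i) (x ∷ xs) = x ∷ lower i xs

nth-lower : ∀ i ν → nth (lower i ν) i ≡ pred (nth ν i)
nth-lower i       []       = refl
nth-lower zero    (x ∷ xs) = refl
nth-lower (suc i) (x ∷ xs) = nth-lower i xs

nth-lower-≢ : ∀ i ν k → k ≢ i → nth (lower i ν) k ≡ nth ν k
nth-lower-≢ i       []       k       k≢ = refl
nth-lower-≢ zero    (x ∷ xs) zero    k≢ = ⊥-elim (k≢ refl)
nth-lower-≢ zero    (x ∷ xs) (suc k) k≢ = refl
nth-lower-≢ (suc i) (x ∷ xs) zero    k≢ = refl
nth-lower-≢ (suc i) (x ∷ xs) (suc k) k≢ = nth-lower-≢ i xs k (k≢ ∘ cong suc)

length-lower : ∀ i ν → length (lower i ν) ≡ length ν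
length-lower i       []       = refl
length-lower zero    (x ∷ xs) = refl
length-lower (suc i) (x ∷ xs) = cong suc (length-lower i xs)

Below-head : ∀ {l l′ ν} → Below l ν → nth ν 0 ≤ l′ → Below l′ ν
Below-head []       _  = []
Below-head (_ ∷ b) x≤ = x≤ ∷ b

Below-lower : ∀ {l} i {ν} → Below l ν → nth ν (suc i) < nth ν i → Below l (lower i ν)
Below-lower i       []             ()
Below-lower zero    {suc x ∷ _} (x≤ ∷ b) (s≤s p) = ℕ.≤-trans (ℕ.n≤1+n _) x≤ ∷ Below-head b p
Below-lower (suc i) (x≤ ∷ b)       p       = x≤ ∷ Below-lower i b p

-- Products of hook lengths over rows

module _ {P : Pred Cell 0ℓ} (P? : Decidable P) (h : Cell → ℕ) where

  private
    Π : List Cell → ℕ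
    Π xs = product (map h (filter P? xs))

    Π-accept : ∀ {x xs} → P x → Π (x ∷ xs) ≡ h x * Π xs
    Π-accept p = cong (product ∘ map h) (List.filter-accept P? p)

    Π-reject : ∀ {x xs} → ¬ P x → Π (x ∷ xs) ≡ Π xs
    Π-reject ¬p = cong (product ∘ map h) (List.filter-reject P? ¬p)

    Π-++ : ∀ xs ys → Π (xs ++ ys) ≡ Π xs * Π ys
    Π-++ xs ys = begin
      product (map h (filter P? (xs ++ ys)))                 ≡⟨ cong (product ∘ map h) (List.filter-++ P? xs ys) ⟩
      product (map h (filter P? xs ++ filter P? ys))         ≡⟨ cong product (List.map-++ h (filter P? xs) _) ⟩
      product (map h (filter P? xs) ++ map h (filter P? ys)) ≡⟨ product-++ (map h (filter P? xs)) _ ⟩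
      Π xs * Π ys                                            ∎
      where open ≡-Reasoning

  product-full-row : ∀ r N (g : ℕ → Cell) → (∀ j → j < N → P (g j)) →
                     (∀ j → j < N → h (g j) ≡ N ∸ j + r) → Π (applyUpTo g N) ≡ rising r N
  product-full-row r zero    g p q = refl
  product-full-row r (suc N) g p q = begin
    Π (g 0 ∷ applyUpTo (g ∘ suc) N)      ≡⟨ Π-accept (p 0 (s≤s z≤n)) ⟩
    h (g 0) * Π (applyUpTo (g ∘ suc) N)
      ≡⟨ cong₂ _*_ (q 0 (s≤s z≤n)) (product-full-row r N (g ∘ suc) (λ j → p (suc j) ∘ s≤s) (λ j → q (suc j) ∘ s≤s)) ⟩
    (suc N + r) * rising r N             ≡⟨ ℕ.*-comm (suc N + r) (rising r N) ⟩
    rising r N * (suc N + r)             ≡⟨ cong (rising r N *_) (ℕ.+-comm (suc N) r) ⟩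
    rising r N * (r + suc N)             ∎
    where open ≡-Reasoning

  -- Cells are stripped from the left: the first x build up `α`, those in columns x to l are
  -- skipped, and from column l + 1 on the row is full.
  product-row : ∀ r N x l (g : ℕ → Cell) → x ≤ l →
                (∀ j → j < N → P (g j) ⇔ (j < x ⊎ l < j)) →
                (∀ j → j < N → h (g j) ≡ N ∸ j + r) → Π (applyUpTo g N) ≡ α r N x * β r N l
  product-row r zero    zero    l       g x≤l p q = refl
  product-row r zero    (suc x) l       g x≤l p q = refl
  product-row r (suc N) zero    zero    g x≤l p q = begin
    Π (g 0 ∷ applyUpTo (g ∘ suc) N) ≡⟨ Π-reject (λ p0 → [ (λ ()) , (λ ()) ]′ (to (p 0 (s≤s z≤n)) p0)) ⟩
    Π (applyUpTo (g ∘ suc) N)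
      ≡⟨ product-full-row r N (g ∘ suc) (λ j j< → from (p (suc j) (s≤s j<)) (inj₂ (s≤s z≤n))) (λ j → q (suc j) ∘ s≤s) ⟩
    rising r N                      ≡⟨ ℕ.*-identityˡ _ ⟨
    1 * rising r N                  ∎
    where open ≡-Reasoning
  product-row r (suc N) zero    (suc l) g x≤l p q =
    trans (Π-reject (λ p0 → [ (λ ()) , (λ ()) ]′ (to (p 0 (s≤s z≤n)) p0)))
          (product-row r N zero l (g ∘ suc) z≤n
            (λ j j< → mk⇔ ([ (λ ()) , inj₂ ∘ s≤s⁻¹ ]′ ∘ to (p (suc j) (s≤s j<)))
                          ([ (λ ()) , from (p (suc j) (s≤s j<)) ∘ inj₂ ∘ s≤s ]′))
            (λ j → q (suc j) ∘ s≤s))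
  product-row r (suc N) (suc x) (suc l) g x≤l p q = begin
    Π (g 0 ∷ applyUpTo (g ∘ suc) N)            ≡⟨ Π-accept (from (p 0 (s≤s z≤n)) (inj₁ (s≤s z≤n))) ⟩
    h (g 0) * Π (applyUpTo (g ∘ suc) N)        ≡⟨ cong₂ _*_ (q 0 (s≤s z≤n)) (product-row r N x l (g ∘ suc) (s≤s⁻¹ x≤l)
        (λ j j< → mk⇔ ([ inj₁ ∘ s≤s⁻¹ , inj₂ ∘ s≤s⁻¹ ]′ ∘ to (p (suc j) (s≤s j<)))
                      (from (p (suc j) (s≤s j<)) ∘ [ inj₁ ∘ s≤s , inj₂ ∘ s≤s ]′))
        (λ j → q (suc j) ∘ s≤s)) ⟩
    (suc N + r) * (α r N x * β r N l)          ≡⟨ ℕ.*-assoc (suc N + r) (α r N x) (β r N l) ⟨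
    α r (suc N) (suc x) * β r N l              ∎
    where open ≡-Reasoning

  -- `nth (l ∷ ν) t` is the number of unmoved cells in the row above row t. At t = `length ν` the
  -- default 0 of `nth` describes the bottom row, which has no unmoved cells.
  product-rows : ∀ N {l ν} (g : ℕ → ℕ) → Below l ν →
    (∀ t j → t ≤ length ν → j < N → P (g t , j) ⇔ (j < nth ν t ⊎ nth (l ∷ ν) t < j)) →
    (∀ t j → t ≤ length ν → j < N → h (g t , j) ≡ N ∸ j + (length ν ∸ t)) →
    Π (cartesianProduct (applyUpTo g (suc (length ν))) (upTo N)) ≡ rowsWeight N (length ν) l ν
  product-rows N {l} {ν} g b p q = begin
    Π (map (g 0 ,_) (upTo N) ++ rest)                             ≡⟨ Π-++ (map (g 0 ,_) (upTo N)) rest ⟩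
    Π (map (g 0 ,_) (upTo N)) * Π rest                            ≡⟨ cong (λ xs → Π xs * Π rest) (List.map-upTo (g 0 ,_) N) ⟩
    Π (applyUpTo (g 0 ,_) N) * Π rest
      ≡⟨ cong (_* Π rest) (product-row (length ν) N (nth ν 0) l _ (nth-Below b 0) (λ j → p 0 j z≤n) (λ j → q 0 j z≤n)) ⟩
    α (length ν) N (nth ν 0) * β (length ν) N l * Π rest          ≡⟨ other-rows b p q ⟩
    rowsWeight N (length ν) l ν                                ∎
    where
    open ≡-Reasoning
    rest = cartesianProduct (applyUpTo (g ∘ suc) (length ν)) (upTo N)

    other-rows : ∀ {l ν} → Below l ν →
      (∀ t j → t ≤ length ν → j < N → P (g t , j) ⇔ (j < nth ν t ⊎ nth (l ∷ ν) t < j)) →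
      (∀ t j → t ≤ length ν → j < N → h (g t , j) ≡ N ∸ j + (length ν ∸ t)) →
      α (length ν) N (nth ν 0) * β (length ν) N l * Π (cartesianProduct (applyUpTo (g ∘ suc) (length ν)) (upTo N)) ≡
      rowsWeight N (length ν) l ν
    other-rows     []             p q = trans (ℕ.*-identityʳ _) (ℕ.*-identityˡ _)
    other-rows {l} (_∷_ {x = x} {xs} x≤ b) p q = cong (α (suc (length xs)) N x * β (suc (length xs)) N l *_)
      (product-rows N (g ∘ suc) b (λ t j → p (suc t) j ∘ s≤s) (λ t j → q (suc t) j ∘ s≤s))

-- Rectangular shapes

-- Cells of the excited diagram in which the first f i cells of row i of
-- the rectangle μ stay in place and the others have moved diagonally.
InDiagram : (ℕ → ℕ) → Cell → Set
InDiagram f (zero  , j) = j < f 0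
InDiagram f (suc i , j) = j < f (suc i) ⊎ f i < j

inDiagram? : ∀ f → Decidable (InDiagram f)
inDiagram? f (zero  , j) = j ℕ.<? f 0
inDiagram? f (suc i , j) = (j ℕ.<? f (suc i)) ⊎-dec (f i ℕ.<? j)

unmoved : ∀ f i {j} → j < f i → InDiagram f (i , j)
unmoved f zero    p = p
unmoved f (suc i) p = inj₁ p

infix 4 _↘_

-- The strict inequality says that no unmoved cell lies directly below the last unmoved cell of row
-- i; past the last entry `nth` supplies 0.
_↘_ : List ℕ → List ℕ → Set
ν ↘ ν′ = ∃[ i ] (nth ν (suc i) < nth ν i × ν′ ≡ lower i ν)

↘-prepend : ∀ x {ν ν′} → ν ↘ ν′ → (x ∷ ν) ↘ (x ∷ ν′)
↘-prepend x (i , p , refl) = suc i , p , refl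

lower-head : ∀ d x {xs} → nth xs 0 ≤ x → Star _↘_ (d + x ∷ xs) (x ∷ xs)
lower-head zero    x p = ε
lower-head (suc d) x p = (0 , s≤s (ℕ.≤-trans p (ℕ.m≤n+m x d)) , refl) ◅ lower-head d x p

-- The tail is lowered first, while the head still equals l, and the head last; so all intermediate
-- lists remain weakly decreasing.
lower-full : ∀ {l ν} → Below l ν → Star _↘_ (replicate (length ν) l) ν
lower-full []                                = ε
lower-full {l} (_∷_ {x = x} {xs} x≤ b) =
  gmap (l ∷_) (↘-prepend l) (lower-full (Below-weaken x≤ b)) ◅◅
  subst (λ z → Star _↘_ (z ∷ xs) (x ∷ xs)) (ℕ.m∸n+n≡m x≤) (lower-head (l ∸ x) x (nth-Below b 0))

nth-replicate-< : ∀ {h} w {i} → i < h → nth (replicate h w) i ≡ w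
nth-replicate-< {suc h} w {zero}  _       = refl
nth-replicate-< {suc h} w {suc i} (s≤s p) = nth-replicate-< w p

rectangle : ℕ → ℕ → Partition
rectangle h w = record
  { parts      = replicate h (suc w)
  ; decreasing = replicate-linked h
  ; positive   = All.replicate⁺ h (s≤s z≤n)
  }
  where
  replicate-linked : ∀ h → Linked _≥_ (replicate h (suc w))
  replicate-linked zero          = []
  replicate-linked (suc zero)    = [-]
  replicate-linked (suc (suc h)) = ℕ.≤-refl ∷ replicate-linked (suc h)

∈-rectangle⁺ : ∀ {h w i j} → i < h → j < suc w → (i , j) ∈𝔻 rectangle h w
∈-rectangle⁺ {h} {w} i< j< rewrite nth-replicate-< {h} (suc w) i< = j<

∈-rectangle⁻ : ∀ h w {i j} → (i , j) ∈𝔻 rectangle h w → i < h × j < suc w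
∈-rectangle⁻ h w {i} {j} p = i< , subst (j <_) (nth-replicate-< (suc w) i<) p
  where i< = subst (i <_) (List.length-replicate h) (nth-<-length (replicate h (suc w)) p)

cells-rectangle : ∀ h w → cells (rectangle (suc h) w) ≡ cartesianProduct (upTo (suc h)) (upTo (suc w))
cells-rectangle h w rewrite List.length-replicate h {suc w} =
  List.filter-all (_∈𝔻? rectangle (suc h) w) (All.tabulate λ c∈ →
    let i∈ , j∈ = ∈-cartesianProduct⁻ (upTo (suc h)) (upTo (suc w)) c∈
    in ∈-rectangle⁺ (∈-upTo⁻ i∈) (∈-upTo⁻ j∈))

-- The hook is the disjoint union of the arm, which includes the cell itself, and the leg strictly
-- below it.
hook-rectangle : ∀ h w {i j} → i < h → j < suc w → hook (rectangle h w) (i , j) ≡ (suc w ∸ j) + (h ∸ suc i)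
hook-rectangle h w {i} {j} i< j< = begin
  length (filter (inHook? (i , j)) (cells lam))                     ≡⟨ ↭-length (unique⇒↭ u v f g) ⟩
  length (applyUpTo arm (suc w ∸ j) ++ applyUpTo leg (h ∸ suc i))   ≡⟨ List.length-++ (applyUpTo arm (suc w ∸ j)) ⟩
  length (applyUpTo arm (suc w ∸ j)) + length (applyUpTo leg (h ∸ suc i))
    ≡⟨ cong₂ _+_ (List.length-applyUpTo arm (suc w ∸ j)) (List.length-applyUpTo leg (h ∸ suc i)) ⟩
  (suc w ∸ j) + (h ∸ suc i)                                         ∎
  where
  open ≡-Reasoning
  lam = rectangle h w
  arm leg : ℕ → Cell
  arm t = i , t + j
  leg t = t + suc i , j

  u = Unique.filter⁺ (inHook? (i , j)) (cells-unique lam)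

  arm-leg-apart : ∀ {c} → ¬ (c ∈ applyUpTo arm (suc w ∸ j) × c ∈ applyUpTo leg (h ∸ suc i))
  arm-leg-apart (c∈₁ , c∈₂) with ∈-applyUpTo⁻ arm c∈₁ | ∈-applyUpTo⁻ leg c∈₂
  ... | _ , _ , refl | t , _ , eq = ℕ.<⇒≢ (ℕ.m≤n+m (suc i) t) (cong proj₁ eq)

  v : Unique (applyUpTo arm (suc w ∸ j) ++ applyUpTo leg (h ∸ suc i))
  v = Unique.++⁺
    (Unique.applyUpTo⁺₁ arm _ (λ {t} {t′} t<t′ _ eq → ℕ.<⇒≢ t<t′ (ℕ.+-cancelʳ-≡ j t t′ (cong proj₂ eq))))
    (Unique.applyUpTo⁺₁ leg _ (λ {t} {t′} t<t′ _ eq → ℕ.<⇒≢ t<t′ (ℕ.+-cancelʳ-≡ (suc i) t t′ (cong proj₁ eq))))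
    arm-leg-apart

  arm∈ : ∀ {j′} → j ≤ j′ → j′ < suc w → (i , j′) ∈ applyUpTo arm (suc w ∸ j)
  arm∈ {j′} j≤ j′< = subst (λ x → (i , x) ∈ applyUpTo arm (suc w ∸ j)) (ℕ.m∸n+n≡m j≤)
    (∈-applyUpTo⁺ arm (ℕ.∸-monoˡ-< j′< j≤))

  f : ∀ {c} → c ∈ filter (inHook? (i , j)) (cells lam) → c ∈ applyUpTo arm (suc w ∸ j) ++ applyUpTo leg (h ∸ suc i)
  f {i′ , j′} c∈ with ∈-filter⁻ (inHook? (i , j)) c∈
  ... | c∈λ , inj₁ (refl , j≤) = ∈-++⁺ˡ (arm∈ j≤ (proj₂ (∈-rectangle⁻ h w (∈-cells⁻ lam c∈λ))))
  ... | c∈λ , inj₂ (refl , i≤) with i ℕ.≟ i′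
  ...   | yes refl = ∈-++⁺ˡ (arm∈ ℕ.≤-refl j<)
  ...   | no i≢    = ∈-++⁺ʳ (applyUpTo arm (suc w ∸ j))
    (subst (λ x → (x , j) ∈ applyUpTo leg (h ∸ suc i)) (ℕ.m∸n+n≡m i<i′)
      (∈-applyUpTo⁺ leg (ℕ.∸-monoˡ-< (proj₁ (∈-rectangle⁻ h w (∈-cells⁻ lam c∈λ))) i<i′)))
    where i<i′ = ℕ.≤∧≢⇒< i≤ i≢

  g : ∀ {c} → c ∈ applyUpTo arm (suc w ∸ j) ++ applyUpTo leg (h ∸ suc i) → c ∈ filter (inHook? (i , j)) (cells lam)
  g c∈ with ∈-++⁻ (applyUpTo arm (suc w ∸ j)) c∈
  ... | inj₁ c∈₁ with t , t< , refl ← ∈-applyUpTo⁻ arm c∈₁ =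
    ∈-filter⁺ (inHook? (i , j)) (∈-cells⁺ lam (∈-rectangle⁺ i< (ℕ.m≤o∸n⇒m+n≤o (suc t) (ℕ.<⇒≤ j<) t<)))
      (inj₁ (refl , ℕ.m≤n+m j t))
  ... | inj₂ c∈₂ with t , t< , refl ← ∈-applyUpTo⁻ leg c∈₂ =
    ∈-filter⁺ (inHook? (i , j)) (∈-cells⁺ lam (∈-rectangle⁺ (ℕ.m≤o∸n⇒m+n≤o (suc t) i< t<) j<))
      (inj₂ (refl , ℕ.≤-trans (ℕ.n≤1+n i) (ℕ.m≤n+m (suc i) t)))

-- Excited diagrams of a rectangle

module Rectangle (r m : ℕ) where

  -- The rectangle λ has n + 1 rows and N columns, and s(I) is N′. Taking n positive gives two equal
  -- first rows and a non-empty descent set.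
  n N′ N : ℕ
  n  = suc r
  N′ = suc m
  N  = suc N′

  lam mu : Partition
  lam = rectangle (suc n) N′
  mu  = rectangle n m

  diagram : (ℕ → ℕ) → List Cell
  diagram f = filter (inDiagram? f) (cells lam)

  ∈-diagram⁺ : ∀ f {i j} → i < suc n → j < N → InDiagram f (i , j) → (i , j) ∈ diagram f
  ∈-diagram⁺ f i< j< = ∈-filter⁺ (inDiagram? f) (∈-cells⁺ lam (∈-rectangle⁺ i< j<))

  ∈-diagram⁻ : ∀ f {c} → c ∈ diagram f → InDiagram f c
  ∈-diagram⁻ f c∈ = proj₂ (∈-filter⁻ (inDiagram? f) {xs = cells lam} c∈)

  record Valid (ν : List ℕ) : Set where
    constructor valid
    field
      length≡ : length ν ≡ n
      below   : Below N′ ν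

    nth>0⇒< : ∀ {i x} → x < nth ν i → i < n
    nth>0⇒< {i} p = subst (i <_) length≡ (nth-<-length ν p)

  open Valid

  Valid-lower : ∀ {ν i} → Valid ν → nth ν (suc i) < nth ν i → Valid (lower i ν)
  Valid-lower {ν} {i} (valid le b) p = valid (trans (length-lower i ν) le) (Below-lower i b p)

  -- Column x holds the last unmoved cell of row i; its image in column x + 1 becomes the leftmost
  -- moved cell of row i + 1.
  excite-diagram : ∀ {ν i x} → Valid ν → nth ν i ≡ suc x →
                   excite lam (diagram (nth ν)) (i , x) ≡ diagram (nth (lower i ν))
  excite-diagram {ν} {i} {x} (valid _ b) νi≡ =
    filter-cong (excited-cell? lam (diagram f) (i , x)) (inDiagram? f′) (cells lam) forward backward
    where
    f f′ : ℕ → ℕ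
    f  = nth ν
    f′ = nth (lower i ν)

    f′i≡ : f′ i ≡ x
    f′i≡ = trans (nth-lower i ν) (cong pred νi≡)

    remains : ∀ k j → (k , j) ≢ (i , x) → j < f k → j < f′ k
    remains k j c≢ j< with k ℕ.≟ i
    ... | no k≢    = subst (j <_) (sym (nth-lower-≢ i ν k k≢)) j<
    ... | yes refl = subst (j <_) (sym f′i≡)
      (ℕ.≤∧≢⇒< (s≤s⁻¹ (subst (j <_) νi≡ j<)) (λ j≡x → c≢ (cong (k ,_) j≡x)))

    f′≤f : ∀ k → f′ k ≤ f k
    f′≤f k with k ℕ.≟ i
    ... | no k≢    = ℕ.≤-reflexive (nth-lower-≢ i ν k k≢)
    ... | yes refl = ℕ.≤-trans (ℕ.≤-reflexive (nth-lower i ν)) ℕ.pred[n]≤n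

    forward : ∀ {c} → c ∈ cells lam → Excited-cell lam (diagram f) (i , x) c → InDiagram f′ c
    forward _ (inj₂ refl) = inj₂ (s≤s (ℕ.≤-reflexive f′i≡))
    forward {zero  , j} _ (inj₁ (c∈ , c≢)) = remains 0 j c≢ (∈-diagram⁻ f c∈)
    forward {suc k , j} _ (inj₁ (c∈ , c≢)) with ∈-diagram⁻ f c∈
    ... | inj₁ p = inj₁ (remains (suc k) j c≢ p)
    ... | inj₂ p = inj₂ (ℕ.≤-<-trans (f′≤f k) p)

    not-corner : ∀ {k j} → j < f′ k → (k , j) ≢ (i , x)
    not-corner j< refl = ℕ.<⇒≢ j< (sym f′i≡)

    backward : ∀ {c} → c ∈ cells lam → InDiagram f′ c → Excited-cell lam (diagram f) (i , x) c
    backward {zero  , j} c∈ p =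
      inj₁ (∈-filter⁺ (inDiagram? f) c∈ (ℕ.<-≤-trans p (f′≤f 0)) , not-corner p)
    backward {suc k , j} c∈ (inj₁ p) =
      inj₁ (∈-filter⁺ (inDiagram? f) c∈ (inj₁ (ℕ.<-≤-trans p (f′≤f (suc k)))) , not-corner p)
    backward {suc k , j} c∈ (inj₂ p) with k ℕ.≟ i
    ... | no k≢ = inj₁ (∈-filter⁺ (inDiagram? f) c∈ (inj₂ fk<j) , c≢)
      where
      fk<j = subst (_< j) (nth-lower-≢ i ν k k≢) p
      -- If this moved cell were the excited one, row k would have fewer unmoved cells than row k +
      -- 1.
      c≢ : (suc k , j) ≢ (i , x)
      c≢ refl = ℕ.<⇒≱ fk<j (ℕ.≤-trans (ℕ.n≤1+n j) (ℕ.≤-trans (ℕ.≤-reflexive (sym νi≡)) (nth-antitone b k)))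
    ... | yes refl with j ℕ.≟ suc x
    ...   | yes refl = inj₂ refl
    ...   | no j≢    = inj₁ (∈-filter⁺ (inDiagram? f) c∈ (inj₂ fk<j) , λ ())
      where fk<j = subst (_< j) (sym νi≡) (ℕ.≤∧≢⇒< (subst (_< j) f′i≡ p) (j≢ ∘ sym))

  lower-⟶ : ∀ {ν ν′} → Valid ν → ν ↘ ν′ → _⟶_ lam (diagram (nth ν)) (diagram (nth ν′))
  lower-⟶ {ν} val (i , p , refl) with nth ν i in νi≡
  ... | suc x = (i , x) , c∈ , (diag∈ , right∉ , down∉ , diag∉) , sym (excite-diagram val νi≡)
    where
    f = nth ν
    x<fi : x < f i
    x<fi = subst (x <_) (sym νi≡) ℕ.≤-refl
    i<n : i < n
    i<n = nth>0⇒< val x<fi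
    sx≤N′ : suc x ≤ N′
    sx≤N′ = subst (_≤ N′) νi≡ (nth-Below (below val) i)
    c∈ = ∈-diagram⁺ f (ℕ.m<n⇒m<1+n i<n) (ℕ.m<n⇒m<1+n sx≤N′) (unmoved f i x<fi)
    diag∈ : diag (i , x) ∈𝔻 lam
    diag∈ = ∈-rectangle⁺ {suc n} {N′} (s≤s i<n) (s≤s sx≤N′)

    right∉ : (i , suc x) ∉ diagram f
    right∉ c∈ = absurd i νi≡ (∈-diagram⁻ f c∈)
      where
      absurd : ∀ i → f i ≡ suc x → ¬ InDiagram f (i , suc x)
      absurd zero    eq q        = ℕ.<⇒≢ q (sym eq)
      absurd (suc i) eq (inj₁ q) = ℕ.<⇒≢ q (sym eq)
      absurd (suc i) eq (inj₂ q) = ℕ.1+n≰n (ℕ.≤-trans q (subst (_≤ f i) eq (nth-antitone (below val) i)))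

    down∉ : (suc i , x) ∉ diagram f
    down∉ c∈ with ∈-diagram⁻ f c∈
    ... | inj₁ q = ℕ.1+n≰n (ℕ.≤-trans q (s≤s⁻¹ p))
    ... | inj₂ q = ℕ.<-asym q x<fi

    diag∉ : (suc i , suc x) ∉ diagram f
    diag∉ c∈ with ∈-diagram⁻ f c∈
    ... | inj₁ q = ℕ.<-asym q p
    ... | inj₂ q = ℕ.<⇒≢ q νi≡

  -- A moved cell cannot be excited again: its right neighbour, if inside the rectangle, also
  -- belongs to the diagram. So an excitable cell is the last unmoved one of its row, and the free
  -- cell below it keeps the lowered list weakly decreasing.
  ⟶-lower : ∀ {ν E} → Valid ν → _⟶_ lam (diagram (nth ν)) E →
            ∃[ ν′ ] (Valid ν′ × E ≡ diagram (nth ν′))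
  ⟶-lower {ν} {E} val ((i , j) , c∈ , (diag∈ , right∉ , down∉ , _) , E≡) =
    corner i (λ q → right∉ (∈-diagram⁺ f (ℕ.<⇒≤ i<) j<  q)) (∈-diagram⁻ f c∈) (down∉ ∘ ∈-diagram⁺ f i< (ℕ.<⇒≤ j<)) E≡
    where
    f = nth ν
    i< : suc i < suc n
    i< = proj₁ (∈-rectangle⁻ (suc n) N′ {suc i} {suc j} diag∈)
    j< : suc j < N
    j< = proj₂ (∈-rectangle⁻ (suc n) N′ {suc i} {suc j} diag∈)

    finish : ∀ i → ¬ suc j < f i → j < f i → ¬ j < f (suc i) → E ≡ excite lam (diagram f) (i , j) →
             ∃[ ν′ ] (Valid ν′ × E ≡ diagram (nth ν′))
    finish i ¬right j<fi ¬down E≡ = lower i ν , Valid-lower {ν} {i} val (ℕ.≤-<-trans (ℕ.≮⇒≥ ¬down) j<fi) ,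
      trans E≡ (excite-diagram val (ℕ.≤-antisym (ℕ.≮⇒≥ ¬right) j<fi))

    corner : ∀ i → ¬ InDiagram f (i , suc j) → InDiagram f (i , j) → ¬ InDiagram f (suc i , j) →
             E ≡ excite lam (diagram f) (i , j) → ∃[ ν′ ] (Valid ν′ × E ≡ diagram (nth ν′))
    corner zero    ¬right p        ¬down = finish zero ¬right p (¬down ∘ inj₁)
    corner (suc i) ¬right (inj₁ p) ¬down = finish (suc i) (¬right ∘ inj₁) p (¬down ∘ inj₁)
    corner (suc i) ¬right (inj₂ p) ¬down = ⊥-elim (¬right (inj₂ (ℕ.m<n⇒m<1+n p)))

  full : List ℕ
  full = replicate n N′

  full-valid : Valid full
  full-valid = valid (List.length-replicate n) (Below-replicate n)
    where
    Below-replicate : ∀ h {l} → Below l (replicate h l)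
    Below-replicate zero    = []
    Below-replicate (suc h) = ℕ.≤-refl ∷ Below-replicate h

  initial≡ : initial lam mu ≡ diagram (nth full)
  initial≡ = filter-cong (_∈𝔻? mu) (inDiagram? (nth full)) (cells lam) (λ {c} _ p → unmoved (nth full) (proj₁ c) p) backward
    where
    backward : ∀ {c} → c ∈ cells lam → InDiagram (nth full) c → c ∈𝔻 mu
    backward {zero  , j} _  p        = p
    backward {suc i , j} _  (inj₁ p) = p
    backward {suc i , j} c∈ (inj₂ p) =
      let i< , j< = ∈-rectangle⁻ (suc n) N′ {suc i} {j} (∈-cells⁻ lam {suc i , j} c∈)
      in ⊥-elim (ℕ.1+n≰n (ℕ.≤-trans (subst (_< j) (nth-replicate-< {n} N′ (s≤s⁻¹ i<)) p) (s≤s⁻¹ j<)))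

  excited⁺ : ∀ {ν} → Valid ν → IsExcited lam mu (diagram (nth ν))
  excited⁺ {ν} val rewrite initial≡ = go full-valid
    (subst (λ k → Star _↘_ (replicate k N′) ν) (length≡ val) (lower-full (below val)))
    where
    go : ∀ {ν₀} → Valid ν₀ → Star _↘_ ν₀ ν → Star (_⟶_ lam) (diagram (nth ν₀)) (diagram (nth ν))
    go val₀ ε = ε
    go {ν₀} val₀ (step@(i , p , refl) ◅ steps) = lower-⟶ val₀ step ◅ go (Valid-lower {ν₀} {i} val₀ p) steps

  excited⁻ : ∀ {D} → IsExcited lam mu D → ∃[ ν ] (Valid ν × D ≡ diagram (nth ν))
  excited⁻ {D} = go full-valid initial≡
    where
    go : ∀ {ν₀ E} → Valid ν₀ → E ≡ diagram (nth ν₀) → Star (_⟶_ lam) E D → ∃[ ν ] (Valid ν × D ≡ diagram (nth ν))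
    go val₀ E≡   ε              = _ , val₀ , E≡
    go val₀ refl (step ◅ steps) = let _ , val₁ , E≡ = ⟶-lower val₀ step in go val₁ E≡ steps

  -- The cell of row i in column `nth ν′ i` is a gap in the diagram of ν′, but would be an unmoved
  -- cell in that of ν if `nth ν i` were larger.
  diagram-injective : ∀ {ν ν′} → Valid ν → Valid ν′ → diagram (nth ν) ≡ diagram (nth ν′) → ν ≡ ν′
  diagram-injective val val′ eq = nth-ext (trans (length≡ val) (sym (length≡ val′)))
    (λ i → ℕ.≤-antisym (half val val′ eq i) (half val′ val (sym eq) i))
    where
    half : ∀ {ν ν′} → Valid ν → Valid ν′ → diagram (nth ν) ≡ diagram (nth ν′) → ∀ i → nth ν i ≤ nth ν′ i
    half {ν} {ν′} val val′ eq i = ℕ.≮⇒≥ λ p → absurd i (∈-diagram⁻ (nth ν′) (subst (_ ∈_) eq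
      (∈-diagram⁺ (nth ν) (ℕ.m<n⇒m<1+n (nth>0⇒< val p)) (ℕ.m<n⇒m<1+n (ℕ.<-≤-trans p (nth-Below (below val) i)))
        (unmoved (nth ν) i p))))
      where
      absurd : ∀ i → ¬ InDiagram (nth ν′) (i , nth ν′ i)
      absurd zero    p        = ℕ.<-irrefl refl p
      absurd (suc i) (inj₁ p) = ℕ.<-irrefl refl p
      absurd (suc i) (inj₂ p) = ℕ.<⇒≱ p (nth-antitone (below val′) i)

  first-row-length : ∀ {ν} → Valid ν → length (filter inFirstRow? (diagram (nth ν))) ≡ nth ν 0
  first-row-length {ν} val = trans
    (↭-length (unique⇒↭ (Unique.filter⁺ inFirstRow? (Unique.filter⁺ (inDiagram? (nth ν)) (cells-unique lam)))
      (Unique.applyUpTo⁺₁ (0 ,_) _ (λ t<t′ _ eq → ℕ.<⇒≢ t<t′ (cong proj₂ eq))) f g))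
    (List.length-applyUpTo (0 ,_) (nth ν 0))
    where
    f : ∀ {c} → c ∈ filter inFirstRow? (diagram (nth ν)) → c ∈ applyUpTo (0 ,_) (nth ν 0)
    f c∈ with c∈D , refl ← ∈-filter⁻ inFirstRow? {xs = diagram (nth ν)} c∈ = ∈-applyUpTo⁺ (0 ,_) (∈-diagram⁻ (nth ν) c∈D)
    g : ∀ {c} → c ∈ applyUpTo (0 ,_) (nth ν 0) → c ∈ filter inFirstRow? (diagram (nth ν))
    g c∈ with t , t< , refl ← ∈-applyUpTo⁻ (0 ,_) c∈ = ∈-filter⁺ inFirstRow?
      (∈-diagram⁺ (nth ν) (s≤s z≤n) (ℕ.m<n⇒m<1+n (ℕ.<-≤-trans t< (nth-Below (below val) 0))) t<) refl

  -- The ribbon and descent set of a rectangle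

  corner-path : ℕ → Cell
  corner-path k = n ∸ (k ∸ N′) , k ⊓ N′

  -- The bottom row from left to right, then the last column upwards, with the corner counted once.
  ribbon : List Cell
  ribbon = applyUpTo corner-path (N + n)

  corner-path-bottom : ∀ {k} → k ≤ N′ → corner-path k ≡ (n , k)
  corner-path-bottom k≤ rewrite ℕ.m≤n⇒m∸n≡0 k≤ | ℕ.m≤n⇒m⊓n≡m k≤ = refl

  corner-path-right : ∀ t → corner-path (N′ + t) ≡ (n ∸ t , N′)
  corner-path-right t rewrite ℕ.m+n∸m≡n N′ t | ℕ.m≥n⇒m⊓n≡n (ℕ.m≤m+n N′ t) = refl

  -- The corner, with index N′, is placed on the right side with t = 0, because the step leaving it
  -- goes up.
  data Position : ℕ → Set where
    onBottom : ∀ {k} → k < N′ → Position k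
    onRight  : ∀ t → t ≤ n → Position (N′ + t)

  position : ∀ {k} → k < N + n → Position k
  position {k} k< with k ℕ.<? N′
  ... | yes k<N′ = onBottom k<N′
  ... | no k≮N′  = subst Position (ℕ.m+[n∸m]≡n (ℕ.≮⇒≥ k≮N′)) (onRight (k ∸ N′)
    (ℕ.+-cancelˡ-≤ N′ (k ∸ N′) n (subst (_≤ N′ + n) (sym (ℕ.m+[n∸m]≡n (ℕ.≮⇒≥ k≮N′))) (s≤s⁻¹ k<))))

  corner-path-rises : ∀ {t} → t < n → corner-path (N′ + t) ≡ down (corner-path (suc (N′ + t)))
  corner-path-rises {t} t<n = begin
    corner-path (N′ + t)              ≡⟨ corner-path-right t ⟩
    (n ∸ t , N′)                      ≡⟨ cong (_, N′) (ℕ.+-∸-assoc 1 (s≤s⁻¹ t<n)) ⟩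
    down (n ∸ suc t , N′)             ≡⟨ cong down (corner-path-right (suc t)) ⟨
    down (corner-path (N′ + suc t))   ≡⟨ cong (down ∘ corner-path) (ℕ.+-suc N′ t) ⟩
    down (corner-path (suc (N′ + t))) ∎
    where open ≡-Reasoning

  isRibbon′ : IsRibbon ribbon
  isRibbon′ = Linked.applyUpTo⁺₁ corner-path (N + n) step
    where
    step : ∀ {k} → suc k < N + n → corner-path (suc k) ≡ right (corner-path k) ⊎ corner-path k ≡ down (corner-path (suc k))
    step {k} k< with position {k} (ℕ.<-trans (ℕ.n<1+n k) k<)
    ... | onBottom k<N′ = inj₁ (trans (corner-path-bottom k<N′) (sym (cong right (corner-path-bottom (ℕ.<⇒≤ k<N′)))))
    ... | onRight t _   = inj₂ (corner-path-rises (ℕ.+-cancelˡ-< N′ t n (s≤s⁻¹ k<)))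

  isRim′ : ∀ c → c ∈ ribbon ⇔ Rim lam c
  isRim′ (i , j) = mk⇔ ribbon⇒rim rim⇒ribbon
    where
    ribbon⇒rim : ∀ {c} → c ∈ ribbon → Rim lam c
    ribbon⇒rim c∈ with k , k< , refl ← ∈-applyUpTo⁻ corner-path c∈ with position k<
    ... | onBottom k<N′ = subst (Rim lam) (sym (corner-path-bottom (ℕ.<⇒≤ k<N′)))
      ( ∈-rectangle⁺ {suc n} {N′} ℕ.≤-refl (ℕ.m<n⇒m<1+n k<N′)
      , λ (_ , down∈ , _) → ℕ.<-irrefl refl (proj₁ (∈-rectangle⁻ (suc n) N′ {suc n} {k} down∈)))
    ... | onRight t t≤n = subst (Rim lam) (sym (corner-path-right t))
      ( ∈-rectangle⁺ {suc n} {N′} (s≤s (ℕ.m∸n≤m n t)) ℕ.≤-refl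
      , λ (right∈ , _) → ℕ.<-irrefl refl (proj₂ (∈-rectangle⁻ (suc n) N′ {n ∸ t} {suc N′} right∈)))

    rim⇒ribbon : Rim lam (i , j) → (i , j) ∈ ribbon
    rim⇒ribbon (c∈ , ¬inner) with i ℕ.<? n | j ℕ.<? N′
    ... | yes i<n | yes j<N′ = ⊥-elim (¬inner
      ( ∈-rectangle⁺ {suc n} {N′} {i} (ℕ.m<n⇒m<1+n i<n) (s≤s j<N′)
      , ∈-rectangle⁺ {suc n} {N′} {suc i} (s≤s i<n) (ℕ.m<n⇒m<1+n j<N′)
      , ∈-rectangle⁺ {suc n} {N′} {suc i} (s≤s i<n) (s≤s j<N′)))
    ... | no i≮n | _ = subst (_∈ ribbon) (trans (corner-path-bottom j≤N′) (cong (_, j) n≡i))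
        (∈-applyUpTo⁺ corner-path (ℕ.<-≤-trans (s≤s j≤N′) (ℕ.m≤m+n N n)))
      where
      i<,j< = ∈-rectangle⁻ (suc n) N′ {i} {j} c∈
      j≤N′  = s≤s⁻¹ (proj₂ i<,j<)
      n≡i   = ℕ.≤-antisym (ℕ.≮⇒≥ i≮n) (s≤s⁻¹ (proj₁ i<,j<))
    ... | yes i<n | no j≮N′ = subst (_∈ ribbon)
        (trans (corner-path-right (n ∸ i)) (cong₂ _,_ (ℕ.m∸[m∸n]≡n (ℕ.<⇒≤ i<n)) N′≡j))
        (∈-applyUpTo⁺ corner-path (s≤s (ℕ.+-monoʳ-≤ N′ (ℕ.m∸n≤m n i))))
      where
      N′≡j = ℕ.≤-antisym (ℕ.≮⇒≥ j≮N′) (s≤s⁻¹ (proj₂ (∈-rectangle⁻ (suc n) N′ {i} {j} c∈)))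

  -- Counted from 1, the corner is cell N, and exactly the n steps from there on go up.
  I : DescentSet
  I = record
    { elements   = applyUpTo (N +_) n
    ; increasing = Linked.applyUpTo⁺₂ (N +_) n (λ t → ℕ.≤-reflexive (sym (ℕ.+-suc N t)))
    ; positive   = All.applyUpTo⁺₂ (N +_) n (λ _ → s≤s z≤n)
    ; nonempty   = λ ()
    }

  S : Shape I
  S = record
    { lam       = lam
    ; mu        = mu
    ; firstRows = refl
    ; ribbon    = ribbon
    ; isRibbon  = isRibbon′
    ; isRim     = isRim′
    ; descents  = λ i → mk⇔ (rises i) (element i)
    ; inner     = λ c → mk⇔ (inner⁺ c) (inner⁻ c)
    }
    where
    rises : ∀ i → i ∈ applyUpTo (N +_) n → RisesAt ribbon i
    rises i i∈ with t , t<n , refl ← ∈-applyUpTo⁻ (N +_) i∈ =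
      let ys , eq = applyUpTo-split⁺ corner-path (N + n) (N′ + t) (s≤s (ℕ.+-monoʳ-< N′ t<n))
      in applyUpTo corner-path (N′ + t) , corner-path (suc (N′ + t)) , ys ,
         trans eq (cong (λ c → applyUpTo corner-path (N′ + t) ++ c ∷ corner-path (suc (N′ + t)) ∷ ys) (corner-path-rises t<n)) ,
         cong suc (sym (List.length-applyUpTo corner-path (N′ + t)))

    rising-index : ∀ {k} → suc k < N + n → down (corner-path (suc k)) ≡ corner-path k → suc k ∈ applyUpTo (N +_) n
    rising-index {k} k< down≡ with position (ℕ.<-trans (ℕ.n<1+n k) k<)
    ... | onRight t _   = ∈-applyUpTo⁺ (N +_) (ℕ.+-cancelˡ-< N′ t n (s≤s⁻¹ k<))
    ... | onBottom k<N′ = ⊥-elim (ℕ.1+n≢n (begin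
      suc k                        ≡⟨ cong proj₂ (corner-path-bottom k<N′) ⟨
      proj₂ (corner-path (suc k))  ≡⟨ cong proj₂ down≡ ⟩
      proj₂ (corner-path k)        ≡⟨ cong proj₂ (corner-path-bottom (ℕ.<⇒≤ k<N′)) ⟩
      k                            ∎))
      where open ≡-Reasoning

    element : ∀ i → RisesAt ribbon i → i ∈ applyUpTo (N +_) n
    element _ (xs , c , ys , eq , refl)
      with k< , down≡ , refl ← applyUpTo-split⁻ corner-path (N + n) xs eq = rising-index k< down≡

    inner⁺ : ∀ c → c ∈𝔻 mu → c ∈𝔻 lam × c ∉ ribbon
    inner⁺ (i , j) c∈ =
      let i< , j< = ∈-rectangle⁻ n m {i} {j} c∈
      in ∈-rectangle⁺ {suc n} {N′} {i} (ℕ.m<n⇒m<1+n i<) (ℕ.m<n⇒m<1+n j<) ,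
         λ c∈r → proj₂ (to (isRim′ (i , j)) c∈r)
           ( ∈-rectangle⁺ {suc n} {N′} {i} (ℕ.m<n⇒m<1+n i<) (s≤s j<)
           , ∈-rectangle⁺ {suc n} {N′} {suc i} (s≤s i<) (ℕ.m<n⇒m<1+n j<)
           , ∈-rectangle⁺ {suc n} {N′} {suc i} (s≤s i<) (s≤s j<))

    inner⁻ : ∀ c → c ∈𝔻 lam × c ∉ ribbon → c ∈𝔻 mu
    inner⁻ (i , j) (c∈ , c∉) with (i , j) ∈𝔻? mu
    ... | yes c∈μ = c∈μ
    ... | no c∉μ  = ⊥-elim (c∉ (from (isRim′ (i , j)) (c∈ , λ (_ , _ , diag∈) →
      let i< , j< = ∈-rectangle⁻ (suc n) N′ {suc i} {suc j} diag∈
      in c∉μ (∈-rectangle⁺ {n} {m} {i} (s≤s⁻¹ i<) (s≤s⁻¹ j<)))))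

  -- Naruse-Newton coefficients of a rectangle

  weight-diagram : ∀ {k ν} → Valid (k ∷ ν) → weight S (diagram (nth (k ∷ ν))) ≡ rowsWeight N r k ν
  weight-diagram {k} {ν} (valid le (k≤ ∷ b)) = begin
    product (map (hook lam) (filter Q? (filter P? (cells lam))))
      ≡⟨ cong (λ xs → product (map (hook lam) (filter Q? (filter P? xs)))) (cells-rectangle n N′) ⟩
    product (map (hook lam) (filter Q? (filter P? (row₀ ++ rest))))
      ≡⟨ cong (λ xs → product (map (hook lam) (filter Q? xs))) (List.filter-++ P? row₀ rest) ⟩
    product (map (hook lam) (filter Q? (filter P? row₀ ++ filter P? rest)))
      ≡⟨ cong (product ∘ map (hook lam)) (List.filter-++ Q? (filter P? row₀) (filter P? rest)) ⟩
    product (map (hook lam) (filter Q? (filter P? row₀) ++ filter Q? (filter P? rest)))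
      ≡⟨ cong (product ∘ map (hook lam)) (cong₂ _++_ drop-row₀ keep-rest) ⟩
    product (map (hook lam) (filter P? rest))
      ≡⟨ cong (λ z → product (map (hook lam) (filter P? (cartesianProduct (applyUpTo suc (suc z)) (upTo N))))) length-ν ⟨
    product (map (hook lam) (filter P? (cartesianProduct (applyUpTo suc (suc (length ν))) (upTo N))))
      -- Row t + 1 of the diagram is row t of the product, with k unmoved cells in the row above the
      -- first one; membership then agrees by definition.
      ≡⟨ product-rows P? (hook lam) N suc b (λ t j _ _ → mk⇔ id id)
           (λ t j t≤ j< → trans (hook-rectangle (suc n) N′ (s≤s (s≤s (subst (t ≤_) length-ν t≤))) j<)
                                (cong (λ z → (N ∸ j) + (z ∸ t)) (sym length-ν))) ⟩
    rowsWeight N (length ν) k ν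
      ≡⟨ cong (λ z → rowsWeight N z k ν) length-ν ⟩
    rowsWeight N r k ν ∎
    where
    open ≡-Reasoning
    P? = inDiagram? (nth (k ∷ ν))
    Q? : Decidable (λ c → ¬ InFirstRow c)
    Q? = ¬? ∘ inFirstRow?
    row₀ = map (0 ,_) (upTo N)
    rest = cartesianProduct (applyUpTo suc n) (upTo N)
    length-ν = ℕ.suc-injective le

    drop-row₀ : filter Q? (filter P? row₀) ≡ []
    drop-row₀ = List.filter-none Q? (All.tabulate λ c∈ ¬q →
      let _ , _ , c≡ = ∈-map⁻ (0 ,_) (proj₁ (∈-filter⁻ P? {xs = row₀} c∈)) in ¬q (cong proj₁ c≡))

    keep-rest : filter Q? (filter P? rest) ≡ filter P? rest
    keep-rest = List.filter-all Q? (All.tabulate λ c∈ → later (proj₁ (∈-filter⁻ P? {xs = rest} c∈)))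
      where
      later : ∀ {c} → c ∈ rest → ¬ InFirstRow c
      later c∈ q with _ , _ , refl ← ∈-applyUpTo⁻ suc (proj₁ (∈-cartesianProduct⁻ (applyUpTo suc n) (upTo N) c∈)) with () ← q

  -- Diagrams with k = N′ - j cells in row 1 are those of the lists k ∷ ν with ν weakly decreasing
  -- and bounded by k.
  C-rectangle : ∀ j → C S j ≡ K N r (N′ ∸ j)
  C-rectangle j = begin
    sum (map (weight S) (filter count? (𝔼 lam mu)))          ≡⟨ sum-↭ (↭-map⁺ (weight S) (unique⇒↭ u v f g)) ⟩
    sum (map (weight S) (map D (decreasingLists r k)))              ≡⟨ cong sum (List.map-∘ (decreasingLists r k)) ⟨
    sum (map (weight S ∘ D) (decreasingLists r k))
      ≡⟨ cong sum (List.map-cong-local (All.tabulate λ ν∈ → weight-diagram (∷-valid ν∈))) ⟩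
    sum (map (rowsWeight N r k) (decreasingLists r k))           ≡⟨ sum-rowsWeight N r k ⟩
    K N r k                                                  ∎
    where
    open ≡-Reasoning
    k = N′ ∸ j
    D : List ℕ → List Cell
    D ν = diagram (nth (k ∷ ν))
    count? : Decidable (λ D → length (filter inFirstRow? D) ≡ s S ∸ j)
    count? D = length (filter inFirstRow? D) ℕ.≟ s S ∸ j

    ∷-valid : ∀ {ν} → ν ∈ decreasingLists r k → Valid (k ∷ ν)
    ∷-valid ν∈ = let le , b = ∈-decreasingLists⁻ r k ν∈ in valid (cong suc le) (ℕ.m∸n≤m N′ j ∷ b)

    u : Unique (filter count? (𝔼 lam mu))
    u = Unique.filter⁺ count? (Unique.filter⁺ (isExcited? lam mu) (subsets-unique (cells-unique lam)))

    v : Unique (map D (decreasingLists r k))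
    v = map-unique (λ ν∈ ν′∈ eq → List.∷-injectiveʳ (diagram-injective (∷-valid ν∈) (∷-valid ν′∈) eq)) (decreasingLists-unique r k)

    f : ∀ {E} → E ∈ filter count? (𝔼 lam mu) → E ∈ map D (decreasingLists r k)
    f E∈ with E∈𝔼 , count ← ∈-filter⁻ count? {xs = 𝔼 lam mu} E∈
      with excited⁻ (proj₂ (∈-filter⁻ (isExcited? lam mu) {xs = subsets (cells lam)} E∈𝔼))
    ... | x ∷ ν , val@(valid le (_ ∷ b)) , refl
      with refl ← trans (sym (first-row-length val)) count
      = ∈-map⁺ D (subst (λ z → ν ∈ decreasingLists z x) (ℕ.suc-injective le) (∈-decreasingLists⁺ b))

    g : ∀ {E} → E ∈ map D (decreasingLists r k) → E ∈ filter count? (𝔼 lam mu)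
    g E∈ with ν , ν∈ , refl ← ∈-map⁻ D E∈ =
      ∈-filter⁺ count? (∈-filter⁺ (isExcited? lam mu) (filter∈subsets (inDiagram? (nth (k ∷ ν))) (cells lam)) (excited⁺ (∷-valid ν∈)))
        (first-row-length (∷-valid ν∈))

-- Positivity and closure

sum-positive : ∀ {x xs} → x ∈ xs → 0 < x → 0 < sum xs
sum-positive              (here refl) p = ℕ.≤-trans p (ℕ.m≤m+n _ _)
sum-positive {xs = y ∷ _} (there x∈)  p = ℕ.≤-trans (sum-positive x∈ p) (ℕ.m≤n+m _ y)

∈⇒length≢0 : ∀ {A : Set} {x : A} {xs} → x ∈ xs → length xs ≢ 0
∈⇒length≢0 (here _)  ()
∈⇒length≢0 (there _) ()

length-unique-constant : ∀ {A : Set} {c : A} {xs} → Unique xs → (∀ {x} → x ∈ xs → x ≡ c) →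
                         length xs ≢ 0 → length xs ≡ 1
length-unique-constant {xs = []}        _                 _  ≢0 = ⊥-elim (≢0 refl)
length-unique-constant {xs = _ ∷ []}    _                 _  _  = refl
length-unique-constant {xs = _ ∷ _ ∷ _} ((x≢y ∷ _) ∷ _) ≡c _  =
  ⊥-elim (x≢y (trans (≡c (here refl)) (sym (≡c (there (here refl))))))

-- Positivity for an arbitrary shape

module _ {I : DescentSet} (S : Shape I) where
  open Shape S

  private
    Subdiagram : List Cell → Set
    Subdiagram D = D ∈ subsets (cells lam) × Unique D

    filter-subdiagram : ∀ {P : Pred Cell 0ℓ} (P? : Decidable P) → Subdiagram (filter P? (cells lam))
    filter-subdiagram P? = filter∈subsets P? (cells lam) , Unique.filter⁺ P? (cells-unique lam)

    firstRowSize : List Cell → ℕ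
    firstRowSize D = length (filter inFirstRow? D)

  -- Every factor is a hook length, and a hook contains its own cell.
  weight-positive : ∀ {D} → D ∈ subsets (cells lam) → 0 < weight S D
  weight-positive {D} D∈ = >-nonZero⁻¹ (weight S D) {{product≢0 (All.map⁺ (All.tabulate hook-nonZero))}}
    where
    hook-nonZero : ∀ {c} → c ∈ filter (¬? ∘ inFirstRow?) D → NonZero (hook lam c)
    hook-nonZero {c} c∈ = ≢-nonZero (∈⇒length≢0 (∈-filter⁺ (inHook? c)
      (∈subsets⇒⊆ (cells lam) D∈ (proj₁ (∈-filter⁻ (¬? ∘ inFirstRow?) {xs = D} c∈))) (inj₁ (refl , ℕ.≤-refl))))

  -- An excited move changes the size of the first row by at most 1, so
  -- no size is skipped on the way to 0.
  single-first-row : ∀ {D E} → Subdiagram D → Star (_⟶_ lam) D E → firstRowSize D ≢ 0 → firstRowSize E ≡ 0 →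
                     ∃[ F ] (Subdiagram F × Star (_⟶_ lam) D F × firstRowSize F ≡ 1)
  single-first-row sub ε D≢0 E≡0 = ⊥-elim (D≢0 E≡0)
  single-first-row {D} sub (step@(c , _ , _ , refl) ◅ steps) D≢0 E≡0 with firstRowSize (excite lam D c) ℕ.≟ 0
  ... | no ≢0  = let F , subF , steps′ , F≡1 = single-first-row (filter-subdiagram _) steps ≢0 E≡0
                 in F , subF , step ◅ steps′ , F≡1
  -- All cells of D other than the excited cell c survive the move, so only c can lie in row 1 of D.
  ... | yes ≡0 = D , sub , ε , length-unique-constant (Unique.filter⁺ inFirstRow? (proj₂ sub)) only-c D≢0
    where
    only-c : ∀ {x} → x ∈ filter inFirstRow? D → x ≡ c
    only-c {x} x∈ with x ≟ᶜ c
    ... | yes x≡c = x≡c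
    ... | no x≢c  = let x∈D , first = ∈-filter⁻ inFirstRow? {xs = D} x∈ in
      ⊥-elim (∈⇒length≢0 (∈-filter⁺ inFirstRow?
        (∈-filter⁺ (excited-cell? lam D c) (∈subsets⇒⊆ (cells lam) (proj₁ sub) x∈D) (inj₁ (x∈D , x≢c))) first) ≡0)

  -- The two equal first rows have length at least 2, so the first cell has all three neighbours and
  -- lies off the rim.
  first-cell-initial : 1 ≤ s S → (0 , 0) ∈ filter inFirstRow? (initial lam mu)
  first-cell-initial 1≤s = ∈-filter⁺ inFirstRow? (∈-filter⁺ (_∈𝔻? mu) (∈-cells⁺ lam 0<λ₀)
    (from (inner (0 , 0)) (0<λ₀ , λ c∈ → proj₂ (to (isRim (0 , 0)) c∈) (1<λ₀ , 0<λ₁ , 1<λ₁)))) refl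
    where
    1<λ₀ : 1 < part lam 0
    1<λ₀ = ℕ.≤-trans (ℕ.≤-reflexive (ℕ.+-comm 1 1)) (ℕ.m≤o∸n⇒m+n≤o 1 (ℕ.<⇒≤ (ℕ.m∸n≢0⇒n<m (ℕ.>⇒≢ 1≤s))) 1≤s)
    0<λ₀ = ℕ.<⇒≤ 1<λ₀
    1<λ₁ = subst (1 <_) firstRows 1<λ₀
    0<λ₁ = ℕ.<⇒≤ 1<λ₁

  -- A non-zero C_s provides an excited diagram that misses row 1; on the way to it lies one with a
  -- single cell in row 1, which contributes a positive weight to C_{s-1}.
  C-positive : 1 ≤ s S → NonZero (C S (s S)) → NonZero (C S (s S ∸ 1))
  C-positive 1≤s nz with filter (λ D → firstRowSize D ℕ.≟ s S ∸ s S) (𝔼 lam mu) in eq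
  ... | [] = ⊥-elim (≢-nonZero⁻¹ 0 {{nz}} refl)
  ... | E ∷ _ = >-nonZero (sum-positive (∈-map⁺ (weight S) F∈) (weight-positive (proj₁ subF)))
    where
    E∈ = ∈-filter⁻ (λ D → firstRowSize D ℕ.≟ s S ∸ s S) {xs = 𝔼 lam mu} (subst (E ∈_) (sym eq) (here refl))
    path = single-first-row (filter-subdiagram (_∈𝔻? mu))
      (proj₂ (∈-filter⁻ (isExcited? lam mu) {xs = subsets (cells lam)} (proj₁ E∈)))
      (∈⇒length≢0 (first-cell-initial 1≤s)) (trans (proj₂ E∈) (ℕ.n∸n≡0 (s S)))
    F    = proj₁ path
    subF = proj₁ (proj₂ path)
    F∈ : F ∈ filter (λ D → firstRowSize D ℕ.≟ s S ∸ (s S ∸ 1)) (𝔼 lam mu)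
    F∈ = ∈-filter⁺ (λ D → firstRowSize D ℕ.≟ s S ∸ (s S ∸ 1))
      (∈-filter⁺ (isExcited? lam mu) (proj₁ subF) (proj₁ (proj₂ (proj₂ path))))
      (trans (proj₂ (proj₂ (proj₂ path))) (sym (ℕ.m∸[m∸n]≡n 1≤s)))

-- Quotients of coefficients as rational numbers

mkℚ≡/ : ∀ u d .(c : Coprime (suc u) (suc d)) x y .{{_ : NonZero y}} → x * suc d ≡ y * suc u → mkℚ (ℤ.+ suc u) d c ≡ (ℤ.+ x) ℚ./ y
mkℚ≡/ u d c x (suc y) eq = trans (sym (ℚ.↥p/↧p≡p (mkℚ (ℤ.+ suc u) d c)))
  (ℚ.fromℚᵘ-cong {mkℚᵘ (ℤ.+ suc u) d} {mkℚᵘ (ℤ.+ x) y} (*≡* (begin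
    ℤ.+ suc u ℤ.* ℤ.+ suc y     ≡⟨ ℤ.pos-* (suc u) (suc y) ⟨
    ℤ.+ (suc u * suc y)       ≡⟨ cong ℤ.+_ (trans (ℕ.*-comm (suc u) (suc y)) (sym eq)) ⟩
    ℤ.+ (x * suc d)           ≡⟨ ℤ.pos-* x (suc d) ⟩
    ℤ.+ x ℤ.* ℤ.+ suc d         ∎)))
  where open ≡-Reasoning

T-intro : ∀ {I} (S : Shape I) a u d .(c : Coprime (suc u) (suc d)) {x y} → suc a ≤ s S →
          C S (s S ∸ a ∸ 1) ≡ x → C S (s S ∸ a) ≡ y → 0 < y → x * suc d ≡ y * suc u →
          T a (mkℚ (ℤ.+ suc u) d c)
T-intro {I} S a u d c a<s refl refl 0<y eq = I , S , a<s , >-nonZero 0<y ,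
  mkℚ≡/ u d c (C S (s S ∸ a ∸ 1)) (C S (s S ∸ a)) {{>-nonZero 0<y}} eq

positive⇒T : ∀ a {q} → 0ℚ ℚ.< q → T a q
positive⇒T a {mkℚ (ℤ.+ zero)   d c} (ℚ.*<* (ℤ.+<+ ()))
positive⇒T a {mkℚ ℤ.-[1+ u ]   d c} (ℚ.*<* ())
positive⇒T a {mkℚ (ℤ.+ suc u)  d c} _ = T-intro S a u d c a<s C-numerator C-denominator (K-positive N r a) K-cross
  where
  -- The target is (u+1)/(d+1). This r makes n + a = (a+1)(u+1), and the width N = a + d + 2 makes N
  -- - a - 1 = d + 1, so the ratio at k = a is the target once a + 1 is cancelled.
  r = u + a * u
  open Rectangle r (d + a) using (N; N′; S; C-rectangle)

  a<s : suc a ≤ N′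
  a<s = s≤s (ℕ.m≤n+m a d)

  C-denominator : C S (N′ ∸ a) ≡ K N r a
  C-denominator = trans (C-rectangle (N′ ∸ a)) (cong (K N r) (ℕ.m∸[m∸n]≡n (ℕ.<⇒≤ a<s)))

  C-numerator : C S (N′ ∸ a ∸ 1) ≡ K N r (suc a)
  C-numerator = trans (C-rectangle (N′ ∸ a ∸ 1)) (cong (K N r)
    (trans (cong (N′ ∸_) (trans (ℕ.∸-+-assoc N′ a 1) (cong (N′ ∸_) (ℕ.+-comm a 1)))) (ℕ.m∸[m∸n]≡n a<s)))

  K-cross : K N r (suc a) * suc d ≡ K N r a * suc u
  K-cross = ℕ.*-cancelʳ-≡ (K N r (suc a) * suc d) (K N r a * suc u) (suc a) (begin
    K N r (suc a) * suc d * suc a     ≡⟨ ring₁ (K N r (suc a)) (suc d) (suc a) ⟩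
    K N r (suc a) * (suc a * suc d)   ≡⟨ K-ratio r a d (ring₂ a d) ⟩
    K N r a * (suc r + a)             ≡⟨ ring₃ (K N r a) u a ⟩
    K N r a * suc u * suc a           ∎)
    where
    open ≡-Reasoning
    ring₁ : ∀ x y z → x * y * z ≡ x * (z * y)
    ring₁ = solve-∀
    ring₂ : ∀ a d → a + suc (suc d) ≡ suc (suc (d + a))
    ring₂ = solve-∀
    ring₃ : ∀ x u a → x * (suc (u + a * u) + a) ≡ x * suc u * suc a
    ring₃ = solve-∀

T⇒nonNegative : ∀ a {q} → T a q → 0ℚ ℚ.≤ q
T⇒nonNegative a (_ , S , _ , nz , refl) =
  ℚ.nonNegative⁻¹ _ {{ℚ.normalize-nonNeg (C S (s S ∸ a ∸ 1)) (C S (s S ∸ a)) {{nz}}}}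

T₀⇒positive : ∀ {q} → T 0 q → 0ℚ ℚ.< q
T₀⇒positive (_ , S , 1≤s , nz , refl) =
  ℚ.positive⁻¹ _ {{ℚ.normalize-pos (C S (s S ∸ 1)) (C S (s S)) {{nz}} {{C-positive S 1≤s nz}}}}

-- Closure in terms of Dedekind cuts

lower-downward : ∀ x {p q} → p ℚ.< q → Lower x q → Lower x p
lower-downward x {p} {q} p<q lq = from (lower-rounded x p) (q , p<q , lq)

lower<upper : ∀ x {p q} → Lower x p → Upper x q → p ℚ.< q
lower<upper x {p} {q} lp uq with ℚ.<-cmp p q
... | tri< p<q _ _  = p<q
... | tri≈ _ refl _ = ⊥-elim (disjoint x p (lp , uq))
... | tri> _ _ q<p  = ⊥-elim (disjoint x q (lower-downward x q<p lp , uq))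

-- Roundedness supplies a smaller upper bound q′; it cannot be negative, and q′ < q gives
-- strictness.
ℝ≥0⇒0<upper : ∀ {x q} → ℝ≥0 x → Upper x q → 0ℚ ℚ.< q
ℝ≥0⇒0<upper {x} {q} x≥0 uq with to (upper-rounded x q) uq
... | q′ , q′<q , uq′ with 0ℚ ℚ.≤? q′
...   | yes 0≤q′ = ℚ.≤-<-trans 0≤q′ q′<q
...   | no 0≰q′  = ⊥-elim (disjoint x q′ (x≥0 q′ (ℚ.≰⇒> 0≰q′) , uq′))

-- If x had a negative upper bound p′, some interval ending at p′ would contain an element of T_a,
-- although these are non-negative.
closure⊆ℝ≥0 : ∀ a {x} → closure (image (T a)) x → ℝ≥0 x
closure⊆ℝ≥0 a {x} cl p p<0 =
  let p′ , p<p′ , p′<0 = ℚ.<-dense p<0 in [ id , ⊥-elim ∘ upper-absurd p′<0 ]′ (located x p p′ p<p′)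
  where
  upper-absurd : ∀ {p′} → p′ ℚ.< 0ℚ → ¬ Upper x p′
  upper-absurd {p′} p′<0 up′ =
    let p₀ , lp₀ = lower-inhabited x
        y , (q , q∈T , _ , q≤y) , _ , uy = cl p₀ p′ lp₀ up′
    in disjoint y p′ (q≤y p′ (ℚ.<-≤-trans p′<0 (T⇒nonNegative a q∈T)) , uy)

-- For an interval from p to q around x, the maximum of a rational between 0 and q and one between p
-- and q is positive and inside the interval, hence an element of T_a there.
ℝ≥0⊆closure : ∀ a {x} → ℝ≥0 x → closure (image (T a)) x
ℝ≥0⊆closure a {x} x≥0 p q lp uq =
  let t  , 0<t  , t<q  = ℚ.<-dense (ℝ≥0⇒0<upper {x} x≥0 uq)
      t′ , p<t′ , t′<q = ℚ.<-dense (lower<upper x lp uq)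
      0<max = ℚ.<-≤-trans 0<t (ℚ.p≤p⊔q t t′)
      p<max = ℚ.<-≤-trans p<t′ (ℚ.p≤q⊔p t t′)
      max<q = [ (λ eq → subst (ℚ._< q) (sym eq) t<q) , (λ eq → subst (ℚ._< q) (sym eq) t′<q) ]′ (ℚ.⊔-sel t t′)
  in fromℚ (t ℚ.⊔ t′) , (t ℚ.⊔ t′ , positive⇒T a 0<max , (λ _ l → l) , (λ _ l → l)) , p<max , max<q

theorem5p3 : (∀ (a : ℕ) → closure (image (T a)) ≐ ℝ≥0) × (T 0 ≐ (0ℚ ℚ.<_))
theorem5p3 = (λ a → (λ {x} → closure⊆ℝ≥0 a {x}) , (λ {x} → ℝ≥0⊆closure a {x})) , T₀⇒positive , positive⇒T 0
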